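{- Let $G$ be a finite simple graph. Then $G$ is cyclically orientable if and only if each of its two-connected components is cyclically orientable. Moreover, a two-connected graph $G$ is cyclically orientable if and only if either $G$ is a cycle, or $G$ is a single edge, or $G = G' \cup C$, where $G'$ and $C$ are subgraphs of $G$ such that $G'$ is cyclically orientable, $C$ is a cycle, and $G'$ and $C$ intersect in exactly a single edge (that edge together with its two endpoints). Finally, if $G = G' \cup C$ is any decomposition of a two-connected graph $G$ into a cycle $C$ and a subgraph $G'$ meeting $C$ along a single edge in this sense, then $G$ is cyclically orientable if and only if $G'$ is cyclically orientable.
   Context: Graphs are finite and simple: a vertex set $\mathrm{Vert}(G)$ and a set $\mathrm{Edge}(G)$ of two-element subsets of $\mathrm{Vert}(G)$. For $S \subseteq \mathrm{Vert}(G)$, $G|_S$ is the induced subgraph on $S$. A cycle in $G$ is a subgraph isomorphic to the graph on $\{1,\dots,n\}$ ($n\ge 3$) with edges $\{1,2\},\dots,\{n-1,n\},\{n,1\}$; it is chordless if it is an induced subgraph of $G$. An orientation of $G$ assigns to each edge an ordering of its endpoints. An orientation of a cycle is cyclic if, in the labeling above, the edges are oriented $(1,2),\dots,(n-1,n),(n,1)$ or all in the opposite direction. An orientation of $G$ is cyclic if its restriction to every chordless cycle of $G$ is cyclic, and $G$ is cyclically orientable if it admits a cyclic orientation. Two edges are equivalent if they are equal or lie on a common cycle; this is an equivalence relation, and the two-connected components of $G$ are the subgraphs consisting of an equivalence class of edges together with their endpoints (these are connected induced subgraphs). A graph is two-connected if it is its own unique two-connected component, i.e. it is connected, has at least one edge,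 and any two edges lie on a common cycle (a single edge is two-connected). -}

module Defs where

open import Data.Nat using (ℕ; zero; suc; _+_)
open import Data.Nat.DivMod using (_%_; m%n<n)
open import Data.Fin using (Fin; toℕ; fromℕ<)
open import Data.Bool using (Bool; true; false; _∨_)
open import Data.Product using (Σ; Σ-syntax; ∃; ∃-syntax; _×_; _,_)
open import Data.Sum using (_⊎_)
open import Relation.Binary.PropositionalEquality using (_≡_; _≢_)
open import Relation.Nullary using (¬_)
open import Function.Definitions using (Injective)
open import Function.Bundles using (_⇔_)

-- Finite simple graphs.  A graph lives on (a subset of) the ambient
-- vertex type Fin n: V u says u is a vertex, E u v says {u,v} is an edge.
-- Every finite simple graph is (isomorphic to) such a record; subgraphs
-- of a graph are again records over the same Fin n.

record Graph (n : ℕ) : Set where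
  field
    V     : Fin n → Bool
    E     : Fin n → Fin n → Bool
    E-sym : ∀ u v → E u v ≡ E v u
    E-irr : ∀ u → E u u ≡ false
    E-V   : ∀ u v → E u v ≡ true → V u ≡ true

open Graph public

_⊆G_ : ∀ {n} → Graph n → Graph n → Set
H ⊆G G = (∀ u → V H u ≡ true → V G u ≡ true)
       × (∀ u v → E H u v ≡ true → E G u v ≡ true)

next : ∀ {k} → Fin (suc k) → Fin (suc k)
next {k} i = fromℕ< (m%n<n (suc (toℕ i)) (suc k))

IsCycle : ∀ {n} → Graph n → Set
IsCycle {n} H =
  Σ[ m ∈ ℕ ] Σ[ c ∈ (Fin (3 + m) → Fin n) ]
      Injective _≡_ _≡_ c
    × (∀ u → (V H u ≡ true) ⇔ (∃[ i ] c i ≡ u))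
    × (∀ u v → (E H u v ≡ true) ⇔
         (∃[ i ] ((c i ≡ u × c (next i) ≡ v) ⊎ (c (next i) ≡ u × c i ≡ v))))

IsSingleEdge : ∀ {n} → Graph n → Set
IsSingleEdge {n} H =
  Σ[ a ∈ Fin n ] Σ[ b ∈ Fin n ]
      a ≢ b
    × (∀ u → (V H u ≡ true) ⇔ (u ≡ a ⊎ u ≡ b))
    × (∀ u v → (E H u v ≡ true) ⇔ ((u ≡ a × v ≡ b) ⊎ (u ≡ b × v ≡ a)))

-- Orientations and cyclic orientations.
-- o u v ≡ true means the edge {u,v} is oriented as (u,v).

IsOrientation : ∀ {n} → Graph n → (Fin n → Fin n → Bool) → Set
IsOrientation H o =
  ∀ u v → E H u v ≡ true →
    (o u v ≡ true × o v u ≡ false) ⊎ (o u v ≡ false × o v u ≡ true)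

IsChordlessCycle : ∀ {n} → Graph n → ∀ {m} → (Fin (3 + m) → Fin n) → Set
IsChordlessCycle H c =
    Injective _≡_ _≡_ c
  × (∀ i → E H (c i) (c (next i)) ≡ true)
  × (∀ i j → E H (c i) (c j) ≡ true → (j ≡ next i ⊎ i ≡ next j))

IsCyclicOrientation : ∀ {n} → Graph n → (Fin n → Fin n → Bool) → Set
IsCyclicOrientation H o =
    IsOrientation H o
  × (∀ m (c : Fin (3 + m) → _) → IsChordlessCycle H c →
       (∀ i → o (c i) (c (next i)) ≡ true)
     ⊎ (∀ i → o (c (next i)) (c i) ≡ true))

CyclicallyOrientable : ∀ {n} → Graph n → Set
CyclicallyOrientable {n} H = ∃[ o ] IsCyclicOrientation H o

EdgeEquiv : ∀ {n} → Graph n → Fin n → Fin n → Fin n → Fin n → Set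
EdgeEquiv {n} H a b c d =
    ((a ≡ c × b ≡ d) ⊎ (a ≡ d × b ≡ c))
  ⊎ (Σ[ C ∈ Graph n ] (C ⊆G H) × IsCycle C
        × E C a b ≡ true × E C c d ≡ true)

IsTwoConnComponent : ∀ {n} → Graph n → Graph n → Set
IsTwoConnComponent {n} G K =
  Σ[ a ∈ Fin n ] Σ[ b ∈ Fin n ]
      E G a b ≡ true
    × (∀ u v → (E K u v ≡ true) ⇔ (E G u v ≡ true × EdgeEquiv G u v a b))
    × (∀ u → (V K u ≡ true) ⇔ (∃[ v ] E K u v ≡ true))

-- G is two-connected: G is its own unique two-connected component, i.e.
-- it has an edge, every vertex lies on an edge, and any two edges are
-- equivalent
TwoConnected : ∀ {n} → Graph n → Set
TwoConnected {n} G =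
    (∃[ a ] ∃[ b ] E G a b ≡ true)
  × (∀ u → V G u ≡ true → ∃[ v ] E G u v ≡ true)
  × (∀ a b c d → E G a b ≡ true → E G c d ≡ true → EdgeEquiv G a b c d)

IsCycleDecomposition : ∀ {n} → Graph n → Graph n → Graph n → Set
IsCycleDecomposition {n} G G' C =
    (G' ⊆G G) × (C ⊆G G) × IsCycle C
  × (∀ u → V G u ≡ (V G' u ∨ V C u))
  × (∀ u v → E G u v ≡ (E G' u v ∨ E C u v))
  × (Σ[ a ∈ Fin n ] Σ[ b ∈ Fin n ]
        E G' a b ≡ true × E C a b ≡ true
      × (∀ u → (V G' u ≡ true × V C u ≡ true) ⇔ (u ≡ a ⊎ u ≡ b))
      × (∀ u v → (E G' u v ≡ true × E C u v ≡ true) →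
                 ((u ≡ a × v ≡ b) ⊎ (u ≡ b × v ≡ a))))

{-# OPTIONS --safe #-}
module Submission where

-- The edges v p and v q of two neighbours of v in a chordless cycle are directed one into v and
-- one out of v.  Hence so are they whenever p and q are joined inside a set W which contains no
-- further neighbour of v, for a shortest such path closes up with v to a chordless cycle.
--
-- It follows that a connected set avoiding a chordless cycle C is attached to C only at the ends
-- of a single edge: build the set up vertex by vertex; when a vertex p first attaches to v ∈ C, it
-- is the only neighbour of v in the set, and if there were attachments beyond both edges of C at v,
-- each pair of the three edges at v leading to p and along C would be one in, one out.
--
-- So take, in a two-connected graph, a part D cut off by the ends of an edge a b, and a chordless
-- cycle C through a b and D.  If C does not exhaust D, what remains contains a smaller part cut off
-- by an edge of C; a minimal part is therefore a cycle glued along an edge.  Conversely, a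
-- chordless cycle of G′ ∪ C either stays in G′ or runs around C, so an orientation of G′ extends.
--
-- Chordless cycles lie within one component, and components are induced on their cycles, because
-- equivalence of edges is transitive: two disjoint paths between edges can be rerouted through a
-- third edge at the places where they first meet.

open import Defs
open import Data.Nat using (ℕ; zero; suc; _+_; _≤_; _<_; z≤n; s≤s; z<s; s<s)
open import Data.Nat.Base using (_≤′_; ≤′-refl; ≤′-step)
open import Data.Nat.Properties as ℕ using ()
open import Data.Nat.DivMod
  using (_%_; _mod_; m%n<n; m%n%n≡m%n; m<n⇒m%n≡m; n%n≡0; [m+n]%n≡m%n; %-distribˡ-+)
open import Data.Fin as Fin using (Fin; zero; suc; toℕ; fromℕ; fromℕ<; finToFun; funToFin)
open import Data.Fin.Properties as Fin
  using (toℕ-fromℕ<; toℕ<n; toℕ-injective; toℕ-fromℕ; any?; all?; finToFun-funToFin; injective⇒≤)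
open import Data.Fin.Subset as Subset using (Subset; ⁅_⁆; _∪_; _⊃_; _⊂_)
  renaming (_∈_ to _∈ₛ_; _∉_ to _∉ₛ_)
open import Data.Fin.Subset.Properties using (_∈?_; x∈⁅x⁆; x∈⁅y⁆⇒x≡y; x∈p∪q⁻; x∈p∪q⁺; ∉⊥)
open import Data.Fin.Subset.Induction using (Acc; acc; ⊂-wellFounded; ⊃-wellFounded)
open import Data.List using (List; []; _∷_; _++_; length; lookup; allFin; cartesianProduct)
open import Data.List.Relation.Unary.All as All using (All; []; _∷_)
open import Data.List.Relation.Unary.All.Properties using (¬Any⇒All¬)
open import Data.List.Relation.Unary.Any as Any using (Any; here; there)
open import Data.List.Relation.Unary.Any.Properties using (lookup-index)
open import Data.List.Relation.Unary.AllPairs using ([]; _∷_)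
open import Data.List.Relation.Unary.Linked using (Linked; []; [-]; _∷_)
open import Data.List.Relation.Unary.Unique.Propositional using (Unique)
open import Data.List.Relation.Unary.Unique.Propositional.Properties using (++⁺)
open import Data.List.Membership.Propositional using (_∈_; _∉_)
open import Data.List.Membership.Propositional.Properties
  using (∈-lookup; ∈-allFin; ∈-cartesianProduct⁺)
open import Data.List.Membership.DecPropositional using () renaming (_∈?_ to member?)
open import Data.Vec using (tabulate)
open import Data.Vec.Properties using (lookup∘tabulate; []=⇒lookup; lookup⇒[]=)
open import Data.Product using (Σ-syntax; ∃; ∃-syntax; _×_; _,_; proj₁; proj₂)
open import Data.Sum as Sum using (_⊎_; inj₁; inj₂; [_,_]′)
open import Data.Bool as Bool using (Bool; true; false; _∨_; if_then_else_)
open import Data.Empty using (⊥; ⊥-elim)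
open import Function using (_∘_; id; case_of_)
open import Function.Definitions using (Injective)
open import Function.Bundles using (_⇔_; mk⇔; Equivalence)
open import Relation.Nullary using (¬_; Dec; yes; no; contradiction; ¬?; does)
open import Relation.Nullary.Decidable
  using (_×-dec_; _⊎-dec_; _→-dec_; map′; decidable-stable; dec-true; dec-false; does-⇔)
open import Relation.Unary using (Decidable)
open import Relation.Binary.PropositionalEquality

private variable
  k l m n : ℕ
  X : Set
  G : Graph n
  S T W W′ Y P Q : Fin n → Set
  a b c d e f p q u v w x y : Fin n
  xs ys : List X

-- Cyclic indices

next-suc : (i j : Fin (suc k)) → toℕ j ≡ suc (toℕ i) → j ≡ next i
next-suc {k} i j eq = toℕ-injective (sym (begin
  toℕ (next i)          ≡⟨ toℕ-fromℕ< (m%n<n (suc (toℕ i)) (suc k)) ⟩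
  suc (toℕ i) % suc k   ≡⟨ cong (_% suc k) (sym eq) ⟩
  toℕ j % suc k         ≡⟨ m<n⇒m%n≡m (toℕ<n j) ⟩
  toℕ j                 ∎))
  where open ≡-Reasoning

next-last : (i : Fin (suc k)) → toℕ i ≡ k → next i ≡ zero
next-last {k} i eq = toℕ-injective
  (trans (toℕ-fromℕ< (m%n<n (suc (toℕ i)) (suc k)))
         (trans (cong (λ j → suc j % suc k) eq) (n%n≡0 (suc k))))

last-or-suc : (i : Fin (suc k)) → toℕ i ≡ k ⊎ ∃[ j ] toℕ {suc k} j ≡ suc (toℕ i)
last-or-suc {k} i with toℕ i ℕ.≟ k
... | yes eq = inj₁ eq
... | no neq = inj₂ (fromℕ< si<sk , toℕ-fromℕ< si<sk)
  where si<sk = s<s (ℕ.≤∧≢⇒< (ℕ.≤-pred (toℕ<n i)) neq)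

mod-toℕ : (i : Fin (suc k)) → toℕ i mod suc k ≡ i
mod-toℕ {k} i = toℕ-injective
  (trans (toℕ-fromℕ< (m%n<n (toℕ i) (suc k))) (m<n⇒m%n≡m (toℕ<n i)))

next-mod : ∀ x → next (x mod suc k) ≡ suc x mod suc k
next-mod {k} x = toℕ-injective (begin
  toℕ (next (x mod suc k))                  ≡⟨ toℕ-fromℕ< _ ⟩
  suc (toℕ (x mod suc k)) % suc k           ≡⟨ cong (λ y → suc y % suc k) (toℕ-fromℕ< _) ⟩
  (1 + x % suc k) % suc k                   ≡⟨ %-distribˡ-+ 1 (x % suc k) (suc k) ⟩
  (1 % suc k + x % suc k % suc k) % suc k   ≡⟨ cong (λ y → (1 % suc k + y) % suc k) (m%n%n≡m%n x (suc k)) ⟩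
  (1 % suc k + x % suc k) % suc k           ≡⟨ %-distribˡ-+ 1 x (suc k) ⟨
  suc x % suc k                             ≡⟨ toℕ-fromℕ< _ ⟨
  toℕ (suc x mod suc k)                     ∎)
  where open ≡-Reasoning

-- Unrolled to a periodic function on ℕ, a cycle can be cut open at any of its vertices.
at : (Fin (suc k) → X) → ℕ → X
at {k} c x = c (x mod suc k)

module _ (c : Fin (suc k) → X) where

  at-toℕ : ∀ i → at c (toℕ i) ≡ c i
  at-toℕ i = cong c (mod-toℕ i)

  at-next : ∀ x → c (next (x mod suc k)) ≡ at c (suc x)
  at-next x = cong c (next-mod x)

  at-suc-toℕ : ∀ i → at c (suc (toℕ i)) ≡ c (next i)
  at-suc-toℕ i = trans (sym (at-next (toℕ i))) (cong (c ∘ next) (mod-toℕ i))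

  at-period : ∀ x → at c (suc k + x) ≡ at c x
  at-period x = cong c (toℕ-injective (begin
    toℕ ((suc k + x) mod suc k) ≡⟨ toℕ-fromℕ< _ ⟩
    (suc k + x) % suc k         ≡⟨ cong (_% suc k) (ℕ.+-comm (suc k) x) ⟩
    (x + suc k) % suc k         ≡⟨ [m+n]%n≡m%n x (suc k) ⟩
    x % suc k                   ≡⟨ toℕ-fromℕ< _ ⟨
    toℕ (x mod suc k)           ∎))
    where open ≡-Reasoning

  at-linked : (R : X → X → Set) → (∀ i → R (c i) (c (next i))) →
              ∀ x → R (at c x) (at c (suc x))
  at-linked R r x = subst (R (at c x)) (at-next x) (r (x mod suc k))

  -- Any `suc k` consecutive positions form a full period. When the window moves up by one, an
  -- offset drops by one, and offset 0 wraps around to `k`.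
  at-covers : ∀ i x → ∃[ s ] s < suc k × at c (s + x) ≡ c i
  at-covers i zero = toℕ i , toℕ<n i , trans (cong (at c) (ℕ.+-identityʳ (toℕ i))) (at-toℕ i)
  at-covers i (suc x) with at-covers i x
  ... | zero  , _  , eq = k , ℕ.n<1+n k ,
    trans (cong (at c) (ℕ.+-suc k x)) (trans (at-period x) eq)
  ... | suc s , s< , eq = s , ℕ.<-trans (ℕ.n<1+n s) s< ,
    trans (cong (at c) (ℕ.+-suc s x)) eq

next-injective : {i j : Fin (suc k)} → next i ≡ next j → i ≡ j
next-injective {k} {i} {j} eq with last-or-suc i | last-or-suc j
... | inj₁ p | inj₁ q = toℕ-injective (trans p (sym q))
... | inj₁ p | inj₂ (j′ , q) =
  case trans (cong toℕ (trans (sym (next-last i p)) (trans eq (sym (next-suc j j′ q))))) q of λ ()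
... | inj₂ (i′ , p) | inj₁ q =
  case trans (cong toℕ (trans (sym (next-last j q)) (trans (sym eq) (sym (next-suc i i′ p))))) p of λ ()
... | inj₂ (i′ , p) | inj₂ (j′ , q) = toℕ-injective (ℕ.suc-injective
  (trans (sym p) (trans (cong toℕ (trans (next-suc i i′ p) (trans eq (sym (next-suc j j′ q))))) q)))

module _ {c : Fin (suc k) → X} (c-inj : Injective _≡_ _≡_ c) where

  at-cancel : ∀ x s t → at c (s + x) ≡ at c (t + x) → at c s ≡ at c t
  at-cancel zero s t eq =
    trans (cong (at c) (sym (ℕ.+-identityʳ s))) (trans eq (cong (at c) (ℕ.+-identityʳ t)))
  at-cancel (suc x) s t eq = at-cancel x s t (cong c (next-injective (begin
    next ((s + x) mod suc k)   ≡⟨ next-mod (s + x) ⟩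
    suc (s + x) mod suc k      ≡⟨ cong (_mod suc k) (ℕ.+-suc s x) ⟨
    (s + suc x) mod suc k      ≡⟨ c-inj eq ⟩
    (t + suc x) mod suc k      ≡⟨ cong (_mod suc k) (ℕ.+-suc t x) ⟩
    suc (t + x) mod suc k      ≡⟨ next-mod (t + x) ⟨
    next ((t + x) mod suc k)   ∎)))
    where open ≡-Reasoning

  at-distinct : ∀ x {s t} → s < suc k → t < suc k → at c (s + x) ≡ at c (t + x) → s ≡ t
  at-distinct x {s} {t} s< t< eq = begin
    s                   ≡⟨ m<n⇒m%n≡m s< ⟨
    s % suc k           ≡⟨ toℕ-fromℕ< _ ⟨
    toℕ (s mod suc k)   ≡⟨ cong toℕ (c-inj (at-cancel x s t eq)) ⟩
    toℕ (t mod suc k)   ≡⟨ toℕ-fromℕ< _ ⟩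
    t % suc k           ≡⟨ m<n⇒m%n≡m t< ⟩
    t                   ∎
    where open ≡-Reasoning

-- Adjacency and chordless cycles

Adj : Graph n → Fin n → Fin n → Set
Adj G u v = E G u v ≡ true

module _ (G : Graph n) where

  adj-sym : ∀ {u v} → Adj G u v → Adj G v u
  adj-sym {u} {v} a = trans (E-sym G v u) a

  adj⇒≢ : ∀ {u v} → Adj G u v → u ≢ v
  adj⇒≢ {u} a refl = case trans (sym a) (E-irr G u) of λ ()

  adj? : ∀ u v → Dec (Adj G u v)
  adj? u v = E G u v Bool.≟ true

  adj-V : ∀ {u v} → Adj G u v → V G u ≡ true
  adj-V = E-V G _ _

module _ (G : Graph n) {c : Fin (3 + m) → Fin n} (ch : IsChordlessCycle G c) where

  private
    c-inj = proj₁ ch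
    edges = proj₁ (proj₂ ch)
    chordless = proj₂ (proj₂ ch)

  -- Seen from position `x`, the two cyclic neighbours have offsets 1 and `2 + m`; chordlessness
  -- allows no other.
  at-chordless : ∀ x {s} → s < 3 + m → Adj G (at c x) (at c (s + x)) → s ≡ 1 ⊎ suc s ≡ 3 + m
  at-chordless x {s} s< a with chordless _ _ a
  ... | inj₁ eq = inj₁ (at-distinct c-inj x s< (s<s z<s)
    (cong c (trans eq (next-mod x))))
  ... | inj₂ eq with suc s ℕ.≟ 3 + m
  ...   | yes p = inj₂ p
  ...   | no ¬p = case at-distinct c-inj x z<s (ℕ.≤∧≢⇒< s< ¬p)
                    (cong c (trans eq (next-mod (s + x)))) of λ ()

-- Closed lists as cycles

unique-lookup : Unique xs → ∀ {i j} → lookup xs i ≡ lookup xs j → i ≡ j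
unique-lookup (_ ∷ _)  {zero}  {zero}  _  = refl
unique-lookup (x∉ ∷ _) {zero}  {suc j} eq = contradiction eq (All.lookup x∉ (∈-lookup j))
unique-lookup (x∉ ∷ _) {suc i} {zero}  eq = contradiction (sym eq) (All.lookup x∉ (∈-lookup i))
unique-lookup (_ ∷ xs!) {suc i} {suc j} eq = cong suc (unique-lookup xs! eq)

linked-lookup : {R : X → X → Set} → Linked R xs → ∀ i j → toℕ j ≡ suc (toℕ i) →
                R (lookup xs i) (lookup xs j)
linked-lookup (r ∷ _)  zero    (suc zero)    _  = r
linked-lookup (_ ∷ rs) (suc i) (suc j)       eq = linked-lookup rs i j (ℕ.suc-injective eq)

closed-lookup : {x : X} {R : X → X → Set} → Linked R (x ∷ xs) →
                R (lookup (x ∷ xs) (fromℕ (length xs))) x →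
                ∀ i → R (lookup (x ∷ xs) i) (lookup (x ∷ xs) (next i))
closed-lookup {xs = xs} {x} {R} rs back i with last-or-suc i
... | inj₁ eq = subst₂ (λ j l → R (lookup (x ∷ xs) j) (lookup (x ∷ xs) l))
  (toℕ-injective (trans (toℕ-fromℕ (length xs)) (sym eq))) (sym (next-last i eq)) back
... | inj₂ (j , eq) =
  subst (λ l → R (lookup (x ∷ xs) i) (lookup (x ∷ xs) l)) (next-suc i j eq) (linked-lookup rs i j eq)

-- Graphs given by decidable relations

does⇔ : {P : Set} (P? : Dec P) → (does P? ≡ true) ⇔ P
does⇔ (yes p) = mk⇔ (λ _ → p) (λ _ → refl)
does⇔ (no ¬p) = mk⇔ (λ ()) (λ p → contradiction p ¬p)

decGraph : {P : Fin n → Set} {Q : Fin n → Fin n → Set} →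
           (∀ u → Dec (P u)) → (∀ u v → Dec (Q u v)) →
           (∀ {u v} → Q u v → Q v u) → (∀ {u} → ¬ Q u u) → (∀ {u v} → Q u v → P u) → Graph n
decGraph P? Q? Q-sym Q-irr Q-P = record
  { V     = λ u → does (P? u)
  ; E     = λ u v → does (Q? u v)
  ; E-sym = λ u v → does-⇔ (mk⇔ Q-sym Q-sym) (Q? u v) (Q? v u)
  ; E-irr = λ u → dec-false (Q? u u) Q-irr
  ; E-V   = λ u v e → dec-true (P? u) (Q-P (Equivalence.to (does⇔ (Q? u v)) e))
  }

ConsecutiveOn : (Fin (suc k) → Fin n) → Fin n → Fin n → Set
ConsecutiveOn c u v = ∃[ i ] ((c i ≡ u × c (next i) ≡ v) ⊎ (c (next i) ≡ u × c i ≡ v))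

consecutive? : (c : Fin (suc k) → Fin n) → ∀ u v → Dec (ConsecutiveOn c u v)
consecutive? c u v = any? λ i →
  (c i Fin.≟ u ×-dec c (next i) Fin.≟ v) ⊎-dec (c (next i) Fin.≟ u ×-dec c i Fin.≟ v)

consecutive-sym : {c : Fin (suc k) → Fin n} → ConsecutiveOn c u v → ConsecutiveOn c v u
consecutive-sym (i , inj₁ (p , q)) = i , inj₂ (q , p)
consecutive-sym (i , inj₂ (p , q)) = i , inj₁ (q , p)

consecutive⇒on : {c : Fin (suc k) → Fin n} → ConsecutiveOn c u v → ∃[ i ] c i ≡ u
consecutive⇒on (i , inj₁ (p , q)) = i , p
consecutive⇒on (i , inj₂ (p , q)) = next i , p

next-≢ : (i : Fin (2 + k)) → next i ≢ i
next-≢ {k} i eq with last-or-suc i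
... | inj₁ p = case trans (sym (cong toℕ (next-last i p))) (trans (cong toℕ eq) p) of λ ()
... | inj₂ (j , p) = ℕ.1+n≢n (trans (sym p) (cong toℕ (trans (next-suc i j p) eq)))

module _ (c : Fin (3 + m) → Fin n) (c-inj : Injective _≡_ _≡_ c) where

  cycleGraph : Graph n
  cycleGraph = decGraph {P = λ u → ∃[ i ] c i ≡ u} {Q = ConsecutiveOn c}
    (λ u → any? λ i → c i Fin.≟ u) (consecutive? c)
    (consecutive-sym {c = c})
    (λ { (i , inj₁ (p , q)) → next-≢ i (c-inj (trans q (sym p)))
       ; (i , inj₂ (p , q)) → next-≢ i (c-inj (trans p (sym q))) })
    (consecutive⇒on {c = c})

  cycleGraph-isCycle : IsCycle cycleGraph
  cycleGraph-isCycle = m , c , c-inj , (λ u → does⇔ (any? λ i → c i Fin.≟ u)) ,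
    (λ u v → does⇔ (consecutive? c u v))

  cycleGraph-⊆ : (∀ i → Adj G (c i) (c (next i))) → cycleGraph ⊆G G
  cycleGraph-⊆ {G = G} edges = onV , onE
    where
    onV : ∀ u → V cycleGraph u ≡ true → V G u ≡ true
    onV u e with Equivalence.to (does⇔ (any? λ i → c i Fin.≟ u)) e
    ... | i , refl = adj-V G (edges i)
    onE : ∀ u v → E cycleGraph u v ≡ true → E G u v ≡ true
    onE u v e with Equivalence.to (does⇔ (consecutive? c u v)) e
    ... | i , inj₁ (refl , refl) = edges i
    ... | i , inj₂ (refl , refl) = adj-sym G (edges i)

-- Walks and induced paths

-- `W` holds at every vertex, both ends included. Disjointness and avoidance of walks thus become
-- statements about predicates.
data Walk (G : Graph n) (W : Fin n → Set) : Fin n → Fin n → Set where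
  stop : W u → Walk G W u u
  step : W u → Adj G u v → Walk G W v w → Walk G W u w

walk-start : Walk G W u v → W u
walk-start (stop x)     = x
walk-start (step x _ _) = x

walk-end : Walk G W u v → W v
walk-end (stop x)     = x
walk-end (step _ _ p) = walk-end p

walk-map : (∀ {x} → W x → W′ x) → Walk G W u v → Walk G W′ u v
walk-map f (stop x)     = stop (f x)
walk-map f (step x a p) = step (f x) a (walk-map f p)

infixr 5 _++ʷ_
_++ʷ_ : Walk G W u v → Walk G W v w → Walk G W u w
stop _     ++ʷ r = r
step x a p ++ʷ r = step x a (p ++ʷ r)

walk-reverse : Walk G W u v → Walk G W v u
walk-reverse (stop x) = stop x
walk-reverse {G = G} (step x a p) = walk-reverse p ++ʷ step (walk-start p) (adj-sym G a) (stop x)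

walk-up : (g : ℕ → Fin n) → (∀ s → Adj G (g s) (g (suc s))) → ∀ {s t} → s ≤′ t →
          (∀ {r} → s ≤ r → r ≤ t → W (g r)) → Walk G W (g s) (g t)
walk-up g link ≤′-refl       inW = stop (inW ℕ.≤-refl ℕ.≤-refl)
walk-up g link {s} (≤′-step {t} s≤t) inW =
  walk-up g link s≤t (λ s≤r r≤t → inW s≤r (ℕ.m≤n⇒m≤1+n r≤t))
    ++ʷ step (inW (ℕ.≤′⇒≤ s≤t) (ℕ.n≤1+n t)) (link t)
             (stop (inW (ℕ.m≤n⇒m≤1+n (ℕ.≤′⇒≤ s≤t)) ℕ.≤-refl))

-- IPath G T u xs: the list u ∷ xs is an induced path, and its last vertex is its only vertex in T.
data IPath (G : Graph n) (T : Fin n → Set) : Fin n → List (Fin n) → Set where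
  end  : T u → IPath G T u []
  cons : ¬ T u → Adj G u v → All (λ x → ¬ (u ≡ x ⊎ Adj G u x)) xs →
         IPath G T v xs → IPath G T u (v ∷ xs)

ipath-unique : IPath G T u xs → Unique (u ∷ xs)
ipath-unique (end _) = [] ∷ []
ipath-unique {G = G} (cons _ a far ip) =
  (adj⇒≢ G a ∷ All.map (λ ¬near eq → ¬near (inj₁ eq)) far) ∷ ipath-unique ip

ipath-linked : IPath G T u xs → Linked (Adj G) (u ∷ xs)
ipath-linked (end _)         = [-]
ipath-linked (cons _ a _ ip) = a ∷ ipath-linked ip

ipath-last : IPath G T u xs → T (lookup (u ∷ xs) (fromℕ (length xs)))
ipath-last (end t)         = t
ipath-last (cons _ _ _ ip) = ipath-last ip

ipath-only-last : IPath G T u xs → ∀ i → T (lookup (u ∷ xs) i) → toℕ i ≡ length xs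
ipath-only-last (end _)          zero    t = refl
ipath-only-last (cons ¬t _ _ _)  zero    t = contradiction t ¬t
ipath-only-last (cons _ _ _ ip)  (suc i) t = cong suc (ipath-only-last ip i t)

ipath-induced : IPath G T u xs → ∀ i j → Adj G (lookup (u ∷ xs) i) (lookup (u ∷ xs) j) →
                toℕ j ≡ suc (toℕ i) ⊎ toℕ i ≡ suc (toℕ j)
ipath-induced {G = G} _                  zero          zero          a = contradiction refl (adj⇒≢ G a)
ipath-induced         (cons _ _ _ _)     zero          (suc zero)    a = inj₁ refl
ipath-induced         (cons _ _ far _)   zero          (suc (suc j)) a =
  contradiction (inj₂ a) (All.lookup far (∈-lookup j))
ipath-induced         (cons _ _ _ _)     (suc zero)    zero          a = inj₂ refl
ipath-induced {G = G} (cons _ _ far _)   (suc (suc i)) zero          a =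
  contradiction (inj₂ (adj-sym G a)) (All.lookup far (∈-lookup i))
ipath-induced         (cons _ _ _ ip)    (suc i)       (suc j)       a =
  [ inj₁ ∘ cong suc , inj₂ ∘ cong suc ]′ (ipath-induced ip i j a)

module _ {G : Graph n} {T W : Fin n → Set} (T? : Decidable T) where

  private
    near? : ∀ u → Decidable (λ x → u ≡ x ⊎ Adj G u x)
    near? u x = (u Fin.≟ x) ⊎-dec adj? G u x

  -- The vertex `u` is joined to the last vertex of the path that is near it, and all earlier ones
  -- are dropped; hence no chord starts at `u`.
  ipath-prepend : ¬ T u → W u → IPath G T v xs → All W (v ∷ xs) →
                  Any (λ x → u ≡ x ⊎ Adj G u x) (v ∷ xs) →
                  ∃[ ys ] IPath G T u ys × All W (u ∷ ys)
  ipath-prepend {u} {v} {xs} ¬t wu ip ws near with Any.any? (near? u) xs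
  ... | no ¬later with near
  ...   | here (inj₁ refl) = xs , ip , ws
  ...   | here (inj₂ a)    = v ∷ xs , cons ¬t a (¬Any⇒All¬ xs ¬later) ip , wu ∷ ws
  ...   | there later      = contradiction later ¬later
  ipath-prepend ¬t wu (cons _ _ _ ip) (_ ∷ ws) _ | yes later = ipath-prepend ¬t wu ip ws later

  -- The walk is cut at its first vertex in `T`. The vertices before that are prepended from last to
  -- first, each skipping ahead as far as possible.
  shorten : Walk G W u w → T w → ∃[ xs ] IPath G T u xs × All W (u ∷ xs)
  shorten (stop wu) t = [] , end t , wu ∷ []
  shorten {u} (step wu a r) t with T? u
  ... | yes tu = [] , end tu , wu ∷ []
  ... | no ¬tu with shorten r t
  ...   | xs , ip , ws = ipath-prepend ¬tu wu ip ws (here (inj₂ a))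

-- Beyond `p`, the neighbours of `v` on the path are exactly its vertices in `T`, which means the
-- last vertex alone. So closing the path through `v` creates no chord.
ipath-cycle : IPath G T p (q ∷ xs) → (∀ {x} → T x → Adj G v x) →
              All (λ x → Adj G v x → T x) (q ∷ xs) → v ∉ p ∷ q ∷ xs → Adj G v p →
              IsChordlessCycle G (lookup (v ∷ p ∷ q ∷ xs))
ipath-cycle {G = G} {p = p} {q} {xs} {v} ip T⇒ ⇒T v∉ a =
  unique-lookup (¬Any⇒All¬ _ v∉ ∷ ipath-unique ip) ,
  closed-lookup (a ∷ ipath-linked ip) (adj-sym G (T⇒ (ipath-last ip))) ,
  chordless
  where
  L = v ∷ p ∷ q ∷ xs
  from-v : ∀ j → Adj G v (lookup L j) → j ≡ next zero ⊎ zero ≡ next j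
  from-v zero          b = contradiction refl (adj⇒≢ G b)
  from-v (suc zero)    b = inj₁ refl
  from-v (suc (suc j)) b = inj₂ (sym (next-last (suc (suc j))
    (cong suc (ipath-only-last ip (suc j) (All.lookup ⇒T (∈-lookup j) b)))))
  chordless : ∀ i j → Adj G (lookup L i) (lookup L j) → j ≡ next i ⊎ i ≡ next j
  chordless zero    j       b = from-v j b
  chordless (suc i) zero    b = [ inj₂ , inj₁ ]′ (from-v (suc i) (adj-sym G b))
  chordless (suc i) (suc j) b =
    [ inj₁ ∘ next-suc (suc i) (suc j) ∘ cong suc , inj₂ ∘ next-suc (suc j) (suc i) ∘ cong suc ]′
      (ipath-induced ip i j b)

local-rule : ∀ {o} → IsCyclicOrientation G o → ¬ W v → Adj G v p → p ≢ q →
             Adj G v q → (∀ {x} → W x → Adj G v x → x ≡ p ⊎ x ≡ q) → Walk G W p q →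
             (o v p ≡ true × o q v ≡ true) ⊎ (o p v ≡ true × o v q ≡ true)
local-rule {v = v} {p} {q} {o} (_ , cyc) v∉W v~p p≢q v~q only r with shorten (Fin._≟ q) r refl
... | [] , end p≡q , _ = contradiction p≡q p≢q
... | y ∷ ys , ip , ws@(_ ∷ ws′) with cyc _ _ (ipath-cycle ip (λ { refl → v~q })
        (All.zipWith (λ { (wx , p≢x) a → [ (λ x≡p → contradiction (sym x≡p) p≢x) , id ]′ (only wx a) })
          (ws′ , p≢ys))
        (λ v∈ → v∉W (All.lookup ws v∈)) v~p)
  where p≢ys = case ipath-unique ip of λ { (h ∷ _) → h }
-- The closing edge, from the last index back to `zero`, is the one from `q` to `v`.
... | inj₁ fwd = inj₁ (fwd zero ,
  subst₂ (λ x y → o x y ≡ true) (ipath-last ip)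
    (cong (lookup (v ∷ p ∷ y ∷ ys)) (next-last final (toℕ-fromℕ _))) (fwd final))
  where final = fromℕ (2 + length ys)
... | inj₂ bwd = inj₂ (bwd zero ,
  subst₂ (λ x y → o y x ≡ true) (ipath-last ip)
    (cong (lookup (v ∷ p ∷ y ∷ ys)) (next-last final (toℕ-fromℕ _))) (bwd final))
  where final = fromℕ (2 + length ys)

-- Attachments to a chordless cycle

prev : Fin (suc k) → Fin (suc k)
prev {k} i = (k + toℕ i) mod suc k

next-prev : (i : Fin (suc k)) → next (prev i) ≡ i
next-prev {k} i = trans (next-mod (k + toℕ i)) (trans (at-period id (toℕ i)) (mod-toℕ i))

orientation-exclusive : ∀ {o} → IsOrientation G o → Adj G u v → o u v ≡ true → o v u ≡ true → ⊥
orientation-exclusive {u = u} {v} or a p q with or u v a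
... | inj₁ (_ , f) = case trans (sym f) q of λ ()
... | inj₂ (f , _) = case trans (sym f) p of λ ()

Connected : Graph n → Subset n → Set
Connected G B = ∀ {u w} → u ∈ₛ B → w ∈ₛ B → Walk G (_∈ₛ B) u w

connected-∪ : {B : Subset n} → Connected G B → q ∈ₛ B → Adj G p q → Connected G (B ∪ ⁅ p ⁆)
connected-∪ {G = G} {q = q} {p = p} {B} conn q∈B p~q {u} {w} u∈ w∈ =
  walk-reverse (from-q u∈) ++ʷ from-q w∈
  where
  p∈ : p ∈ₛ B ∪ ⁅ p ⁆
  p∈ = x∈p∪q⁺ (inj₂ (x∈⁅x⁆ p))
  from-q : ∀ {u} → u ∈ₛ B ∪ ⁅ p ⁆ → Walk G (_∈ₛ B ∪ ⁅ p ⁆) q u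
  from-q u∈ with x∈p∪q⁻ B ⁅ p ⁆ u∈
  ... | inj₁ u∈B = walk-map (λ x∈ → x∈p∪q⁺ (inj₁ x∈)) (conn q∈B u∈B)
  ... | inj₂ u∈p with refl ← x∈⁅y⁆⇒x≡y p u∈p =
    step (x∈p∪q⁺ (inj₁ q∈B)) (adj-sym G p~q) (stop p∈)

module _ {G : Graph n} {o} (cyc : IsCyclicOrientation G o)
         {c : Fin (3 + m) → Fin n} (ch : IsChordlessCycle G c) where

  Avoids : Subset n → Set
  Avoids B = ∀ {u} → u ∈ₛ B → ∀ j → u ≢ c j

  AttachedAt : Fin (3 + m) → Subset n → Set
  AttachedAt i B = ∀ {u} → u ∈ₛ B → ∀ j → Adj G u (c j) → j ≡ i ⊎ j ≡ next i

  private
    attached-else? : ∀ i B → AttachedAt i B ⊎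
      ∃[ u ] ∃[ j ] u ∈ₛ B × Adj G u (c j) × j ≢ i × j ≢ next i
    attached-else? i B
      with any? (λ u → any? λ j →
        u ∈? B ×-dec adj? G u (c j) ×-dec ¬? (j Fin.≟ i) ×-dec ¬? (j Fin.≟ next i))
    ... | yes found = inj₂ found
    ... | no none = inj₁ λ {u} u∈B j a → decidable-stable ((j Fin.≟ i) ⊎-dec (j Fin.≟ next i))
      λ neither → none (u , j , u∈B , a , neither ∘ inj₁ , neither ∘ inj₂)

  -- If B reached beyond both edges of the cycle at c j, the local rule at c j would apply to each
  -- of the three pairs of edges among c j – c (prev j), c j – p and c j – c (next j); but in-edges
  -- and out-edges at a vertex cannot alternate around a triangle.
  unique-attachment : ∀ {B p j} → Connected G B → Avoids B → p ∈ₛ B → Adj G p (c j) →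
                      (∀ {u} → u ∈ₛ B → Adj G u (c j) → u ≡ p) → ∃[ i ] AttachedAt i B
  unique-attachment {B} {p} {j} conn avoid p∈B p~cj unique
    with attached-else? j B | attached-else? (prev j) B
  ... | inj₁ att | _        = j , att
  ... | inj₂ _   | inj₁ att = prev j , att
  ... | inj₂ (u₁ , i₁ , u₁∈B , a₁ , i₁≢j , i₁≢next) | inj₂ (u₂ , i₂ , u₂∈B , a₂ , i₂≢prev , i₂≢)
    with at-covers c i₁ (toℕ j) | at-covers c i₂ (toℕ j)
  ... | s₁ , s₁< , e₁ | s₂ , s₂< , e₂ = ⊥-elim absurd
    where
    -- The cycle is cut open at `c j`: `g 0` is `c j` itself, `g 1` its successor and `g (2 + m)`
    -- its predecessor.
    x₀ = toℕ j
    g : ℕ → Fin n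
    g s = at c (s + x₀)
    c-inj = proj₁ ch
    edge = at-linked c (Adj G) (proj₁ (proj₂ ch))

    link : ∀ s → Adj G (g s) (g (suc s))
    link s = edge (s + x₀)

    g0 : g 0 ≡ c j
    g0 = at-toℕ c j

    avoid-g : ∀ {u} → u ∈ₛ B → ∀ s → u ≢ g s
    avoid-g u∈B s = avoid u∈B _

    v~p : Adj G (g 0) p
    v~p = subst (λ y → Adj G y p) (sym g0) (adj-sym G p~cj)

    v~last : Adj G (g 0) (g (2 + m))
    v~last = adj-sym G (subst (Adj G (g (2 + m))) (at-period c x₀) (link (2 + m)))

    1<s₁ : 1 < s₁
    1<s₁ = ℕ.≤∧≢⇒< (ℕ.≤∧≢⇒< z≤n λ { refl → i₁≢j (c-inj (trans (sym e₁) g0)) })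
      λ { refl → i₁≢next (c-inj (trans (sym e₁) (at-suc-toℕ c j))) }

    0<s₂ : 0 < s₂
    0<s₂ = ℕ.≤∧≢⇒< z≤n λ { refl → i₂≢ (trans (c-inj (trans (sym e₂) g0)) (sym (next-prev j))) }

    s₂<last : s₂ < 2 + m
    s₂<last = ℕ.≤∧≢⇒< (ℕ.≤-pred s₂<) λ { refl → i₂≢prev (c-inj (sym e₂)) }

    -- The set `W` for the local rule: `B` and an arc of the cycle that omits `g 0` and one of its
    -- two neighbours.
    Arc : ℕ → ℕ → Fin n → Set
    Arc lo hi y = y ∈ₛ B ⊎ ∃[ s ] lo ≤ s × s ≤ hi × g s ≡ y

    g0∉Arc : ∀ {lo hi} → 0 < lo → hi < 3 + m → ¬ Arc lo hi (g 0)
    g0∉Arc 0<lo hi< (inj₁ g0∈B) = avoid-g g0∈B 0 refl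
    g0∉Arc 0<lo hi< (inj₂ (s , lo≤s , s≤hi , eq))
      with refl ← at-distinct c-inj x₀ (ℕ.≤-<-trans s≤hi hi<) z<s eq = case ℕ.<-≤-trans 0<lo lo≤s of λ ()

    rule₁ : (o (g 0) p ≡ true × o (g (2 + m)) (g 0) ≡ true) ⊎
            (o p (g 0) ≡ true × o (g 0) (g (2 + m)) ≡ true)
    -- The walk runs through `B` from `p` to `u₁`, crosses to the cycle beyond `g 1` and climbs to
    -- `g (2 + m)`. For `rule₂` it crosses from `u₂` and descends to `g 1`.
    rule₁ = local-rule cyc (g0∉Arc {2} {2 + m} z<s ℕ.≤-refl) v~p (avoid-g p∈B (2 + m)) v~last only
      (walk-map inj₁ (conn p∈B u₁∈B) ++ʷ
       step (inj₁ u₁∈B) (subst (Adj G u₁) (sym e₁) a₁)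
        (walk-up g link (ℕ.≤⇒≤′ (ℕ.≤-pred s₁<)) λ s₁≤r r≤ → inj₂ (_ , ℕ.≤-trans 1<s₁ s₁≤r , r≤ , refl)))
      where
      only : ∀ {y} → Arc 2 (2 + m) y → Adj G (g 0) y → y ≡ p ⊎ y ≡ g (2 + m)
      only (inj₁ y∈B) a = inj₁ (unique y∈B (adj-sym G (subst (λ z → Adj G z _) g0 a)))
      only (inj₂ (s , 2≤s , s≤ , refl)) a with at-chordless G ch x₀ (s≤s s≤) a
      ... | inj₁ refl = case 2≤s of λ { (s≤s ()) }
      ... | inj₂ refl = inj₂ refl

    rule₂ : (o (g 0) p ≡ true × o (g 1) (g 0) ≡ true) ⊎
            (o p (g 0) ≡ true × o (g 0) (g 1) ≡ true)
    rule₂ = local-rule cyc (g0∉Arc {1} {1 + m} z<s (ℕ.m≤n⇒m≤1+n ℕ.≤-refl)) v~p (avoid-g p∈B 1) (link 0) only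
      (walk-map inj₁ (conn p∈B u₂∈B) ++ʷ
       step (inj₁ u₂∈B) (subst (Adj G u₂) (sym e₂) a₂)
        (walk-reverse (walk-up g link (ℕ.≤⇒≤′ 0<s₂)
          λ 1≤r r≤ → inj₂ (_ , 1≤r , ℕ.≤-trans r≤ (ℕ.≤-pred s₂<last) , refl))))
      where
      only : ∀ {y} → Arc 1 (1 + m) y → Adj G (g 0) y → y ≡ p ⊎ y ≡ g 1
      only (inj₁ y∈B) a = inj₁ (unique y∈B (adj-sym G (subst (λ z → Adj G z _) g0 a)))
      only (inj₂ (s , 1≤s , s≤ , refl)) a
        with at-chordless G ch x₀ (s≤s (ℕ.m≤n⇒m≤1+n s≤)) a
      ... | inj₁ refl = inj₂ refl
      ... | inj₂ refl = contradiction s≤ (ℕ.<⇒≱ (ℕ.n<1+n _))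

    excl : ∀ {u v} → Adj G u v → o u v ≡ true → o v u ≡ true → ⊥
    excl = orientation-exclusive {G = G} (proj₁ cyc)

    absurd : ⊥
    absurd with proj₂ cyc m c ch | rule₁ | rule₂
    ... | inj₁ fwd | inj₂ (_ , vl) | _             = excl v~last vl
      (subst (λ z → o (g (2 + m)) z ≡ true) (at-period c x₀)
        (at-linked c (λ y z → o y z ≡ true) fwd (2 + m + x₀)))
    ... | inj₁ fwd | inj₁ (vp , _) | inj₁ (_ , fv) =
      excl (link 0) (at-linked c (λ y z → o y z ≡ true) fwd x₀) fv
    ... | inj₁ _   | inj₁ (vp , _) | inj₂ (pv , _) = excl v~p vp pv
    ... | inj₂ bwd | inj₁ (_ , lv) | _             = excl v~last
      (subst (λ z → o z (g (2 + m)) ≡ true) (at-period c x₀)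
        (at-linked c (λ y z → o z y ≡ true) bwd (2 + m + x₀))) lv
    ... | inj₂ bwd | inj₂ (pv , _) | inj₂ (_ , vf) =
      excl (link 0) vf (at-linked c (λ y z → o z y ≡ true) bwd x₀)
    ... | inj₂ _   | inj₂ (pv , _) | inj₁ (vp , _) = excl v~p vp pv

  -- If `p` sees some `c j` that `B` does not, it is the only neighbour of `c j` in `B′`, and
  -- `unique-attachment` finds an edge anew. Otherwise `p` adds no attachments and the old edge
  -- remains valid.
  attached-extend : ∀ {B B′ p} → Connected G B′ → Avoids B′ → p ∈ₛ B′ →
                    (∀ {u} → u ∈ₛ B′ → u ∈ₛ B ⊎ u ≡ p) →
                    ∃[ i ] AttachedAt i B → ∃[ i ] AttachedAt i B′
  attached-extend {B} {B′} {p} conn avoid p∈ split (i , att)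
    with any? (λ j → adj? G p (c j) ×-dec ¬? (any? λ u → u ∈? B ×-dec adj? G u (c j)))
  ... | yes (j , p~cj , fresh) = unique-attachment conn avoid p∈ p~cj λ u∈ u~cj →
    [ (λ u∈B → contradiction (_ , u∈B , u~cj) fresh) , id ]′ (split u∈)
  ... | no stale = i , λ u∈ j u~cj → case split u∈ of λ
    { (inj₁ u∈B)  → att u∈B j u~cj
    ; (inj₂ refl) → case decidable-stable (any? λ u → u ∈? B ×-dec adj? G u (c j))
                           (λ none → stale (j , u~cj , none)) of λ
        { (u , u∈B , a) → att u∈B j a } }

  -- `B` is the connected component of `d` once the cycle is removed from `G`; `connected`, `avoids`
  -- and `closed` determine it.
  record Bridge (d : Fin n) : Set where
    field
      B         : Subset n
      d∈B       : d ∈ₛ B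
      connected : Connected G B
      avoids    : Avoids B
      attached  : ∃[ i ] AttachedAt i B
      closed    : ∀ {u v} → u ∈ₛ B → Adj G u v → v ∈ₛ B ⊎ ∃[ j ] v ≡ c j

  bridge : ∀ d → (∀ j → d ≢ c j) → Bridge d
  bridge d d∉c = grow ⁅ d ⁆ (⊃-wellFounded _) (x∈⁅x⁆ d) conn₀ avoid₀
    -- The singleton extends the empty set, which has no attachments, so any index does for the
    -- latter; `zero` is chosen.
    (attached-extend {B = Subset.⊥} conn₀ avoid₀ (x∈⁅x⁆ d) (λ u∈ → inj₂ (x∈⁅y⁆⇒x≡y d u∈))
      (zero , λ u∈⊥ → contradiction u∈⊥ ∉⊥))
    where
    conn₀ : Connected G ⁅ d ⁆
    conn₀ u∈ w∈ with refl ← x∈⁅y⁆⇒x≡y d u∈ | refl ← x∈⁅y⁆⇒x≡y d w∈ = stop u∈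

    avoid₀ : Avoids ⁅ d ⁆
    avoid₀ u∈ j with refl ← x∈⁅y⁆⇒x≡y d u∈ = d∉c j

    grow : ∀ B → Acc _⊃_ B → d ∈ₛ B → Connected G B → Avoids B → ∃[ i ] AttachedAt i B → Bridge d
    grow B (acc rec) d∈B conn avoid att
      with any? (λ p → ¬? (p ∈? B) ×-dec ¬? (any? λ j → p Fin.≟ c j) ×-dec
                       any? λ q → q ∈? B ×-dec adj? G p q)
    ... | no none = record
      { B = B ; d∈B = d∈B ; connected = conn ; avoids = avoid ; attached = att
      ; closed = λ {u} {v} u∈B u~v → decidable-stable ((v ∈? B) ⊎-dec any? λ j → v Fin.≟ c j)
          λ out → none (v , out ∘ inj₁ , out ∘ inj₂ , u , u∈B , adj-sym G u~v) }
    ... | yes (p , p∉B , p∉c , q , q∈B , p~q) =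
      grow (B ∪ ⁅ p ⁆) (rec ((λ x∈ → x∈p∪q⁺ (inj₁ x∈)) , p , p∈ , p∉B)) (x∈p∪q⁺ (inj₁ d∈B)) conn′ avoid′
        (attached-extend {B = B} conn′ avoid′ p∈ split att)
      where
      p∈ : p ∈ₛ B ∪ ⁅ p ⁆
      p∈ = x∈p∪q⁺ (inj₂ (x∈⁅x⁆ p))
      conn′ : Connected G (B ∪ ⁅ p ⁆)
      conn′ = connected-∪ conn q∈B p~q
      split : ∀ {u} → u ∈ₛ B ∪ ⁅ p ⁆ → u ∈ₛ B ⊎ u ≡ p
      split u∈ = [ inj₁ , inj₂ ∘ x∈⁅y⁆⇒x≡y p ]′ (x∈p∪q⁻ B ⁅ p ⁆ u∈)
      avoid′ : Avoids (B ∪ ⁅ p ⁆)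
      avoid′ u∈ j eq with split u∈
      ... | inj₁ u∈B  = avoid u∈B j eq
      ... | inj₂ refl = p∉c (j , eq)

-- Equivalence of edges

-- For edges a b and c d: either the two edges are equal or, after shortening the walks to paths,
-- they lie on the cycle a … c d … b.
Linkage : Graph n → (a b c d : Fin n) → Set₁
Linkage {n} G a b c d = Σ[ S ∈ (Fin n → Set) ] Σ[ T ∈ (Fin n → Set) ]
  Walk G S a c × Walk G T b d × (∀ {x} → S x → T x → ⊥)

linkage-swap : Linkage G a b c d → Linkage G b a d c
linkage-swap (S , T , r , s , disj) = T , S , s , r , λ t s → disj s t

linkage-refl : a ≢ b → Linkage G a b a b
linkage-refl {a = a} {b} a≢b = (_≡ a) , (_≡ b) , stop refl , stop refl , λ { refl a≡b → a≢b a≡b }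

-- The sharpened predicate on the walk is what later keeps a spliced walk off the paths it joins,
-- except at the junction.
first-hit : Decidable Y → Walk G S u w → Y w →
            ∃[ x ] Y x × S x × Walk G (λ z → S z × (Y z → z ≡ x)) u x
first-hit Y? (stop su) yu = _ , yu , su , stop (su , λ _ → refl)
first-hit {u = u} Y? (step su a r) yw with Y? u
... | yes yu = u , yu , su , stop (su , λ _ → refl)
... | no ¬yu with first-hit Y? r yw
...   | x , yx , sx , r′ = x , yx , sx , step (su , λ yu → contradiction yu ¬yu) a r′

ipath-from : IPath G (_≡ w) u xs → x ∈ u ∷ xs → Walk G (_∈ u ∷ xs) x w
ipath-from (end refl)      (here refl) = stop (here refl)
ipath-from (cons _ a _ ip) (here refl) = step (here refl) a (walk-map there (ipath-from ip (here refl)))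
ipath-from (cons _ _ _ ip) (there x∈)  = walk-map there (ipath-from ip x∈)

-- For a path `u … x … y … w`, the two outer pieces, with the stretch between `x` and `y` left out.
Split : Graph n → List (Fin n) → (u x y w : Fin n) → Set₁
Split {n} G xs u x y w = Σ[ S ∈ (Fin n → Set) ] Σ[ T ∈ (Fin n → Set) ]
  Walk G S u x × Walk G T y w ×
  (∀ {z} → S z → z ∈ xs) × (∀ {z} → T z → z ∈ xs) × (∀ {z} → S z → T z → ⊥)

split-cons : u ∉ xs → Adj G u v → Split G xs v x y w → Split G (u ∷ xs) u x y w
split-cons {u = u} u∉ a (S , T , r , s , S⊆ , T⊆ , disj) =
  (λ z → z ≡ u ⊎ S z) , T , step (inj₁ refl) a (walk-map inj₂ r) , s ,
  (λ { (inj₁ refl) → here refl ; (inj₂ sz) → there (S⊆ sz) }) , there ∘ T⊆ ,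
  λ { (inj₁ refl) tz → u∉ (T⊆ tz) ; (inj₂ sz) tz → disj sz tz }

ipath-∉ : IPath G T u (v ∷ xs) → u ∉ v ∷ xs
ipath-∉ {G = G} (cons _ a _   _) (here refl) = adj⇒≢ G a refl
ipath-∉ {G = G} (cons _ _ far _) (there u∈)  = All.lookup far u∈ (inj₁ refl)

split-at-head : IPath G (_≡ w) u xs → y ∈ u ∷ xs → u ≢ y → Split G (u ∷ xs) u u y w
split-at-head ip (here refl) u≢y = contradiction refl u≢y
split-at-head {u = u} ip@(cons {xs = xs} _ _ _ ip′) (there y∈) u≢y =
  (_≡ u) , (_∈ _ ∷ xs) , stop refl , ipath-from ip′ y∈ , (λ { refl → here refl }) , there ,
  λ { refl → ipath-∉ ip }

-- The alternative records which of `x` and `y` comes first along the path.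
ipath-split : IPath G (_≡ w) u xs → x ∈ u ∷ xs → y ∈ u ∷ xs → x ≢ y →
              Split G (u ∷ xs) u x y w ⊎ Split G (u ∷ xs) u y x w
ipath-split ip (here refl) y∈ x≢y = inj₁ (split-at-head ip y∈ x≢y)
ipath-split ip x∈@(there _) (here refl) x≢y = inj₂ (split-at-head ip x∈ (x≢y ∘ sym))
ipath-split ip@(cons _ a _ ip′) (there x∈) (there y∈) x≢y =
  Sum.map (split-cons (ipath-∉ ip) a) (split-cons (ipath-∉ ip) a) (ipath-split ip′ x∈ y∈ x≢y)

-- The walks from e and f have been cut off where they first meet the paths xs from a to c and
-- ys from b to d, namely in x and y.
module _ {xs ys : List (Fin n)} (xs#ys : ∀ {z} → z ∈ xs → z ∈ ys → ⊥)
         (P#Q : ∀ {z} → P z → Q z → ⊥)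
         (P-hits : ∀ {z} → P z → z ∈ xs ⊎ z ∈ ys → z ≡ x)
         (Q-hits : ∀ {z} → Q z → z ∈ xs ⊎ z ∈ ys → z ≡ y)
         (e→x : Walk G P e x) (f→y : Walk G Q f y) where

  -- The walks from `e` and `f` land on different paths, so each path is followed up to its landing
  -- point and then left.
  splice-apart : Walk G (_∈ xs) a x → Walk G (_∈ ys) b y → Linkage G a b e f
  splice-apart a→x b→y =
    (λ z → z ∈ xs ⊎ P z) , (λ z → z ∈ ys ⊎ Q z) ,
    walk-map inj₁ a→x ++ʷ walk-reverse (walk-map inj₂ e→x) ,
    walk-map inj₁ b→y ++ʷ walk-reverse (walk-map inj₂ f→y) ,
    λ { (inj₁ z∈xs) (inj₁ z∈ys) → xs#ys z∈xs z∈ys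
      ; (inj₁ z∈xs) (inj₂ qz)   → case Q-hits qz (inj₁ z∈xs) of λ { refl → xs#ys z∈xs (walk-end b→y) }
      ; (inj₂ pz)   (inj₁ z∈ys) → case P-hits pz (inj₂ z∈ys) of λ { refl → xs#ys (walk-end a→x) z∈ys }
      ; (inj₂ pz)   (inj₂ qz)   → P#Q pz qz }

  -- Both walks land on `xs`, with `x` first. From `a` the path leads to `x` and out to `e`; from
  -- `b` the route takes all of `ys`, crosses the edge `d c`, comes back along `xs` to `y` and
  -- leaves for `f`.
  splice-together : Split G xs a x y c → Walk G (_∈ ys) b d → Adj G d c → Linkage G a b e f
  splice-together (S , T , a→x , y→c , S⊆ , T⊆ , S#T) b→d d~c =
    (λ z → S z ⊎ P z) , (λ z → z ∈ ys ⊎ T z ⊎ Q z) ,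
    walk-map inj₁ a→x ++ʷ walk-reverse (walk-map inj₂ e→x) ,
    walk-map inj₁ b→d ++ʷ step (inj₁ (walk-end b→d)) d~c
      (walk-map (inj₂ ∘ inj₁) (walk-reverse y→c) ++ʷ walk-reverse (walk-map (inj₂ ∘ inj₂) f→y)) ,
    λ { (inj₁ sz) (inj₁ z∈ys)      → xs#ys (S⊆ sz) z∈ys
      ; (inj₁ sz) (inj₂ (inj₁ tz)) → S#T sz tz
      ; (inj₁ sz) (inj₂ (inj₂ qz)) → case Q-hits qz (inj₁ (S⊆ sz)) of λ { refl → S#T sz (walk-start y→c) }
      ; (inj₂ pz) (inj₁ z∈ys)      → case P-hits pz (inj₂ z∈ys) of λ { refl → xs#ys (S⊆ (walk-end a→x)) z∈ys }
      ; (inj₂ pz) (inj₂ (inj₁ tz)) → case P-hits pz (inj₁ (T⊆ tz)) of λ { refl → S#T (walk-end a→x) tz }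
      ; (inj₂ pz) (inj₂ (inj₂ qz)) → P#Q pz qz }

ipath-to : IPath G (_≡ w) u xs → x ∈ u ∷ xs → Walk G (_∈ u ∷ xs) u x
ipath-to ip             (here refl) = stop (here refl)
ipath-to (cons _ a _ ip) (there x∈) = step (here refl) a (walk-map there (ipath-to ip x∈))

-- The walks from `e` and `f` back to `c` and `d` are followed until they first meet one of the
-- paths `a … c` and `b … d`. The places of these two meetings decide how `e` and `f` are paired
-- with `a` and `b`.
linkage-trans : Adj G c d → Linkage G a b c d → Linkage G c d e f →
                Linkage G a b e f ⊎ Linkage G a b f e
linkage-trans {G = G} c~d (S , T , a→c , b→d , S#T) (S′ , T′ , c→e , d→f , S′#T′)
  with shorten (Fin._≟ _) a→c refl | shorten (Fin._≟ _) b→d refl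
... | xs , L , inS | ys , M , inT
  with first-hit (λ z → member? Fin._≟_ z (_ ∷ xs) ⊎-dec member? Fin._≟_ z (_ ∷ ys)) (walk-reverse c→e)
         (inj₁ (walk-end (ipath-from L (here refl))))
     | first-hit (λ z → member? Fin._≟_ z (_ ∷ xs) ⊎-dec member? Fin._≟_ z (_ ∷ ys)) (walk-reverse d→f)
         (inj₂ (walk-end (ipath-from M (here refl))))
... | x , hx , sx , e→x | y , hy , ty , f→y = splice hx hy
  where
  xs#ys : ∀ {z} → z ∈ _ ∷ xs → z ∈ _ ∷ ys → ⊥
  xs#ys z∈xs z∈ys = S#T (All.lookup inS z∈xs) (All.lookup inT z∈ys)
  x≢y : x ≢ y
  x≢y refl = S′#T′ sx ty
  P#Q : ∀ {z} → S′ z × _ → T′ z × _ → ⊥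
  P#Q (s , _) (t , _) = S′#T′ s t
  a→c′ = ipath-from L (here refl)
  b→d′ = ipath-from M (here refl)

  splice : x ∈ _ ∷ xs ⊎ x ∈ _ ∷ ys → y ∈ _ ∷ xs ⊎ y ∈ _ ∷ ys → Linkage G _ _ _ _ ⊎ Linkage G _ _ _ _
  splice (inj₁ x∈) (inj₁ y∈) with ipath-split L x∈ y∈ x≢y
  ... | inj₁ sp = inj₁ (splice-together xs#ys P#Q proj₂ proj₂ e→x f→y sp b→d′ (adj-sym G c~d))
  ... | inj₂ sp = inj₂ (splice-together xs#ys (λ q p → P#Q p q) proj₂ proj₂ f→y e→x sp b→d′ (adj-sym G c~d))
  splice (inj₁ x∈) (inj₂ y∈) =
    inj₁ (splice-apart xs#ys P#Q proj₂ proj₂ e→x f→y (ipath-to L x∈) (ipath-to M y∈))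
  splice (inj₂ x∈) (inj₁ y∈) =
    inj₂ (splice-apart xs#ys (λ q p → P#Q p q) proj₂ proj₂ f→y e→x (ipath-to L y∈) (ipath-to M x∈))
  -- The mirror image of the first case: the two paths, and with them `a` and `b`, exchange roles.
  splice (inj₂ x∈) (inj₂ y∈) with ipath-split M x∈ y∈ x≢y
  ... | inj₁ sp = inj₂ (linkage-swap (splice-together (λ s t → xs#ys t s) P#Q
          (λ p → proj₂ p ∘ Sum.swap) (λ q → proj₂ q ∘ Sum.swap) e→x f→y sp a→c′ c~d))
  ... | inj₂ sp = inj₁ (linkage-swap (splice-together (λ s t → xs#ys t s) (λ q p → P#Q p q)
          (λ q → proj₂ q ∘ Sum.swap) (λ p → proj₂ p ∘ Sum.swap) f→y e→x sp a→c′ c~d))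

module _ {G : Graph n} {c : Fin (3 + m) → Fin n} (c-inj : Injective _≡_ _≡_ c)
         (edges : ∀ i → Adj G (c i) (c (next i))) where

  private
    link : ∀ x s → Adj G (at c (s + x)) (at c (suc s + x))
    link x s = at-linked c (Adj G) edges (s + x)

  -- The cycle is cut open between `c i` and `c (next i)`. If the edge at `j` is another one, it
  -- occupies offsets `s` and `suc s`, and the offsets up to `s` and from `suc s` on carry the two
  -- walks.
  cycle-linkage : ∀ i j → Linkage G (c i) (c (next i)) (c j) (c (next j)) ⊎
                          Linkage G (c i) (c (next i)) (c (next j)) (c j)
  cycle-linkage i j with at-covers c (next j) (suc (toℕ i))
  ... | zero , _ , eq with refl ← next-injective {i = i} {j} (c-inj (trans (sym (at-suc-toℕ c i)) eq)) =
    inj₁ (linkage-refl (λ eq′ → next-≢ i (sym (c-inj eq′))))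
  ... | suc s , s< , eq = inj₂
    ( (λ z → ∃[ t ] suc s ≤ t × t ≤ 2 + m × g t ≡ z)
    , (λ z → ∃[ t ] t ≤ s × g t ≡ z)
    , subst₂ (Walk G _) ci eq (walk-reverse (walk-up g (link x₀) (ℕ.≤⇒≤′ (ℕ.≤-pred s<))
        λ s<r r≤ → _ , s<r , r≤ , refl))
    , subst₂ (Walk G _) (at-suc-toℕ c i)
        (cong c (next-injective (trans (next-mod (s + x₀)) (c-inj eq))))
        (walk-up g (link x₀) (ℕ.≤⇒≤′ z≤n) λ _ r≤ → _ , r≤ , refl)
    , λ { (t , s<t , t≤ , refl) (t′ , t′≤s , eq′) →
          ℕ.<⇒≱ s<t (subst (_≤ s)
            (at-distinct c-inj x₀ (ℕ.≤-<-trans t′≤s (ℕ.<-trans (ℕ.n<1+n s) s<)) (s≤s t≤) eq′) t′≤s) }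
    )
    where
    x₀ = suc (toℕ i)
    g : ℕ → Fin n
    g t = at c (t + x₀)
    ci : g (2 + m) ≡ c i
    ci = trans (cong (at c) (ℕ.+-suc (2 + m) (toℕ i))) (trans (at-period c (toℕ i)) (at-toℕ c i))

  -- The arc from `c j` back to `c (next i)` misses `c i`. A chord from `c i` to `c j` therefore
  -- lies on a common cycle with an edge of the given cycle.
  chord-linkage : ∀ i j → i ≢ j → Linkage G (c i) (c j) (c i) (c (next i))
  chord-linkage i j i≢j with at-covers c j (toℕ i)
  ... | zero , _ , eq = contradiction (c-inj (trans (sym (at-toℕ c i)) eq)) i≢j
  ... | suc s , s< , eq =
    (_≡ c i) , (λ z → ∃[ t ] 1 ≤ t × t ≤ suc s × g t ≡ z) , stop refl ,
    subst₂ (Walk G _) eq (at-suc-toℕ c i) (walk-reverse (walk-up g (link x₀) (ℕ.≤⇒≤′ (s≤s z≤n))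
        λ 1≤r r≤ → _ , 1≤r , r≤ , refl)) ,
    λ { refl (t , 1≤t , t≤ , eq′) →
        case at-distinct c-inj x₀ (ℕ.≤-<-trans t≤ s<) z<s (trans eq′ (sym (at-toℕ c i))) of
          λ { refl → case 1≤t of λ () } }
    where
    x₀ = toℕ i
    g : ℕ → Fin n
    g t = at c (t + x₀)

equiv-sym : (G : Graph n) → EdgeEquiv G a b c d → EdgeEquiv G c d a b
equiv-sym G (inj₁ (inj₁ (refl , refl)))     = inj₁ (inj₁ (refl , refl))
equiv-sym G (inj₁ (inj₂ (refl , refl)))     = inj₁ (inj₂ (refl , refl))
equiv-sym G (inj₂ (C , C⊆ , cyc , ab , cd)) = inj₂ (C , C⊆ , cyc , cd , ab)

equiv-flipʳ : (G : Graph n) → EdgeEquiv G a b c d → EdgeEquiv G a b d c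
equiv-flipʳ G (inj₁ (inj₁ (refl , refl)))     = inj₁ (inj₂ (refl , refl))
equiv-flipʳ G (inj₁ (inj₂ (refl , refl)))     = inj₁ (inj₁ (refl , refl))
equiv-flipʳ G (inj₂ (C , C⊆ , cyc , ab , cd)) = inj₂ (C , C⊆ , cyc , ab , adj-sym C cd)

equiv-flipˡ : (G : Graph n) → EdgeEquiv G a b c d → EdgeEquiv G b a c d
equiv-flipˡ G eq = equiv-sym G (equiv-flipʳ G (equiv-sym G eq))

equiv⇒linkage : (G : Graph n) → Adj G a b → EdgeEquiv G a b c d → Linkage G a b c d ⊎ Linkage G a b d c
equiv⇒linkage G a~b (inj₁ (inj₁ (refl , refl))) = inj₁ (linkage-refl (adj⇒≢ G a~b))
equiv⇒linkage G a~b (inj₁ (inj₂ (refl , refl))) = inj₂ (linkage-refl (adj⇒≢ G a~b))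
equiv⇒linkage G _ (inj₂ (C , (_ , C⊆) , (m , s , s-inj , _ , E⇔) , ab , cd))
  with Equivalence.to (E⇔ _ _) ab | Equivalence.to (E⇔ _ _) cd
... | i , e₁ | j , e₂ with cycle-linkage {G = G} s-inj
        (λ l → C⊆ _ _ (Equivalence.from (E⇔ _ _) (l , inj₁ (refl , refl)))) i j
equiv⇒linkage _ _ _ | i , inj₁ (refl , refl) | j , inj₁ (refl , refl) | l = l
equiv⇒linkage _ _ _ | i , inj₁ (refl , refl) | j , inj₂ (refl , refl) | l = Sum.swap l
equiv⇒linkage _ _ _ | i , inj₂ (refl , refl) | j , inj₁ (refl , refl) | l =
  Sum.map linkage-swap linkage-swap (Sum.swap l)
equiv⇒linkage _ _ _ | i , inj₂ (refl , refl) | j , inj₂ (refl , refl) | l =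
  Sum.map linkage-swap linkage-swap l

closed⇒equiv : (G : Graph n) → ∀ x xs → Unique (x ∷ xs) → Linked (Adj G) (x ∷ xs) →
               Adj G (lookup (x ∷ xs) (fromℕ (length xs))) x → 2 ≤ length xs →
               ConsecutiveOn (lookup (x ∷ xs)) a b → ConsecutiveOn (lookup (x ∷ xs)) c d →
               EdgeEquiv G a b c d
closed⇒equiv G x (_ ∷ []) _ _ _ (s≤s ())
closed⇒equiv G x (y ∷ z ∷ zs) xs! linked back _ ab cd =
  inj₂ (cycleGraph s s-inj , cycleGraph-⊆ s s-inj {G = G} (closed-lookup {R = Adj G} linked back) ,
    cycleGraph-isCycle s s-inj ,
    Equivalence.from (does⇔ (consecutive? s _ _)) ab , Equivalence.from (does⇔ (consecutive? s _ _)) cd)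
  where
  s = lookup (x ∷ y ∷ z ∷ zs)
  s-inj : Injective _≡_ _≡_ s
  s-inj = unique-lookup xs!

ipath-++ : IPath G (_≡ c) a xs → Adj G c d → Linked (Adj G) (d ∷ ys) → Linked (Adj G) (a ∷ xs ++ d ∷ ys)
ipath-++ (end refl)      c~d l = c~d ∷ l
ipath-++ (cons _ e _ ip) c~d l = e ∷ ipath-++ ip c~d l

ipath-++-seam : IPath G (_≡ c) a xs → let L = a ∷ xs ++ d ∷ ys in
                ∃[ i ] ∃[ j ] toℕ j ≡ suc (toℕ i) × lookup L i ≡ c × lookup L j ≡ d
ipath-++-seam (end refl) = zero , suc zero , refl , refl , refl
ipath-++-seam (cons _ _ _ ip) with ipath-++-seam ip
... | i , j , eq , ei , ej = suc i , suc j , cong suc eq , ei , ej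

ipath-++-consecutive : IPath G (_≡ c) a xs → ConsecutiveOn (lookup (a ∷ xs ++ d ∷ ys)) c d
ipath-++-consecutive {a = a} {xs = xs} {d = d} {ys = ys} ip with ipath-++-seam {d = d} {ys = ys} ip
... | i , j , eq , ei , ej =
  i , inj₁ (ei , trans (cong (lookup (a ∷ xs ++ d ∷ ys)) (sym (next-suc i j eq))) ej)

++-last : ∀ (a : Fin n) xs d ys → lookup (a ∷ xs ++ d ∷ ys) (fromℕ (length (xs ++ d ∷ ys))) ≡
                                  lookup (d ∷ ys) (fromℕ (length ys))
++-last a []       d ys = refl
++-last a (x ∷ xs) d ys = ++-last x xs d ys

-- The paths `a … c` and `d … b`, joined by the edge `c d` and closed by `b a`, form the common
-- cycle. If both are trivial, the edges coincide; otherwise the cycle has at least three vertices.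
linkage⇒equiv : (G : Graph n) → ∀ {a b c d} → Adj G a b → Adj G c d →
                Linkage G a b c d → EdgeEquiv G a b c d
linkage⇒equiv G {a} {b} {c} {d} a~b c~d (S , T , a→c , b→d , S#T)
  with shorten (Fin._≟ c) a→c refl | shorten (Fin._≟ b) (walk-reverse b→d) refl
... | [] , end refl , _ | [] , end refl , _ = inj₁ (inj₁ (refl , refl))
... | [] , L , inS | y ∷ ys , M , inT =
  closed⇒equiv G a (d ∷ y ∷ ys)
    (++⁺ (ipath-unique L) (ipath-unique M) λ (l , r) → S#T (All.lookup inS l) (All.lookup inT r))
    (ipath-++ L c~d (ipath-linked M))
    (subst (λ z → Adj G z a) (sym last≡b) (adj-sym G a~b)) (s≤s (s≤s z≤n))
    (fromℕ _ , inj₂ (cong (lookup (a ∷ d ∷ y ∷ ys)) (next-last (fromℕ _) (toℕ-fromℕ _)) , last≡b))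
    (ipath-++-consecutive L)
  where last≡b = trans (++-last a [] d (y ∷ ys)) (ipath-last M)
... | x ∷ xs , L , inS | ys , M , inT =
  closed⇒equiv G a (x ∷ xs ++ d ∷ ys)
    (++⁺ (ipath-unique L) (ipath-unique M) λ (l , r) → S#T (All.lookup inS l) (All.lookup inT r))
    (ipath-++ L c~d (ipath-linked M))
    (subst (λ z → Adj G z a) (sym last≡b) (adj-sym G a~b)) (s≤s (1≤length xs))
    (fromℕ _ , inj₂ (cong (lookup (a ∷ x ∷ xs ++ d ∷ ys)) (next-last (fromℕ _) (toℕ-fromℕ _)) , last≡b))
    (ipath-++-consecutive L)
  where
  last≡b = trans (++-last a (x ∷ xs) d ys) (ipath-last M)
  1≤length : ∀ xs → 1 ≤ length (xs ++ d ∷ ys)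
  1≤length []      = s≤s z≤n
  1≤length (_ ∷ _) = s≤s z≤n

equiv-trans : (G : Graph n) → ∀ {a b c d e f} → Adj G a b → Adj G c d → Adj G e f →
              EdgeEquiv G a b c d → EdgeEquiv G c d e f → EdgeEquiv G a b e f
equiv-trans G {a} {b} {c} {d} {e} {f} a~b c~d e~f ab~cd cd~ef = 
  case equiv⇒linkage G a~b ab~cd , equiv⇒linkage G c~d cd~ef of λ
    { (inj₁ l , inj₁ r) → result (linkage-trans c~d l r)
    ; (inj₁ l , inj₂ r) → result (Sum.swap (linkage-trans c~d l r))
    ; (inj₂ l , inj₁ r) → result (Sum.swap (linkage-trans (adj-sym G c~d) l (linkage-swap r)))
    ; (inj₂ l , inj₂ r) → result (linkage-trans (adj-sym G c~d) l (linkage-swap r)) }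
  where
  result : Linkage G a b e f ⊎ Linkage G a b f e → EdgeEquiv G a b e f
  result = [ linkage⇒equiv G a~b e~f , equiv-flipʳ G ∘ linkage⇒equiv G a~b (adj-sym G e~f) ]′

-- Deciding equivalence of edges

any-function? : {P : (Fin k → Fin n) → Set} → (∀ f → Dec (P f)) →
                (∀ {f g} → f ≗ g → P f → P g) → Dec (∃ P)
any-function? P? resp = map′ (λ (i , p) → _ , p)
  (λ (f , p) → funToFin f , resp (sym ∘ finToFun-funToFin f) p)
  (any? (P? ∘ finToFun))

CycleThrough : Graph n → (a b c d : Fin n) → (Fin (3 + m) → Fin n) → Set
CycleThrough G a b c d s = (∀ i j → s i ≡ s j → i ≡ j) × (∀ i → Adj G (s i) (s (next i))) ×
                           ConsecutiveOn s a b × ConsecutiveOn s c d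

cycleThrough? : ∀ (G : Graph n) a b c d (s : Fin (3 + m) → Fin n) → Dec (CycleThrough G a b c d s)
cycleThrough? G a b c d s =
  all? (λ i → all? λ j → s i Fin.≟ s j →-dec i Fin.≟ j) ×-dec all? (λ i → adj? G (s i) (s (next i))) ×-dec
  consecutive? s a b ×-dec consecutive? s c d

consecutive-resp : {s t : Fin (suc k) → Fin n} → s ≗ t → ConsecutiveOn s a b → ConsecutiveOn t a b
consecutive-resp s≗t (i , inj₁ (p , q)) = i , inj₁ (trans (sym (s≗t i)) p , trans (sym (s≗t (next i))) q)
consecutive-resp s≗t (i , inj₂ (p , q)) = i , inj₂ (trans (sym (s≗t (next i))) p , trans (sym (s≗t i)) q)

cycleThrough-resp : (G : Graph n) → {s t : Fin (3 + m) → Fin n} → s ≗ t →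
                    CycleThrough G a b c d s → CycleThrough G a b c d t
cycleThrough-resp G s≗t (inj , edges , ab , cd) =
  (λ i j eq → inj i j (trans (s≗t i) (trans eq (sym (s≗t j))))) ,
  (λ i → subst₂ (Adj G) (s≗t i) (s≗t (next i)) (edges i)) ,
  consecutive-resp s≗t ab , consecutive-resp s≗t cd

OnCommonCycle : Graph n → (a b c d : Fin n) → Set
OnCommonCycle {n} G a b c d = Σ[ C ∈ Graph n ] (C ⊆G G) × IsCycle C × E C a b ≡ true × E C c d ≡ true

abstract
  -- A cycle has at most `n` vertices by injectivity, so it suffices to try finitely many lengths
  -- and labelings.
  edgeEquiv? : ∀ (G : Graph n) a b c d → Dec (EdgeEquiv G a b c d)
  edgeEquiv? {n} G a b c d =
    ((a Fin.≟ c ×-dec b Fin.≟ d) ⊎-dec (a Fin.≟ d ×-dec b Fin.≟ c)) ⊎-dec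
    map′ to from (any? {n = n} λ m → any-function? (cycleThrough? {m = toℕ m} G a b c d) (cycleThrough-resp G))
    where
    to : (∃[ m ] ∃[ s ] CycleThrough {m = toℕ {n} m} G a b c d s) → OnCommonCycle G a b c d
    to (m , s , inj , edges , ab , cd) = cycleGraph s s-inj , cycleGraph-⊆ s s-inj {G = G} edges ,
      cycleGraph-isCycle s s-inj ,
      Equivalence.from (does⇔ (consecutive? s _ _)) ab , Equivalence.from (does⇔ (consecutive? s _ _)) cd
      where
      s-inj : Injective _≡_ _≡_ s
      s-inj = inj _ _
    from : OnCommonCycle G a b c d → ∃[ m ] ∃[ s ] CycleThrough {m = toℕ {n} m} G a b c d s
    from (C , (_ , C⊆) , (m , s , s-inj , _ , E⇔) , ab , cd) =
      fromℕ< m<n , subst (λ l → ∃[ s ] CycleThrough {m = l} G a b c d s) (sym (toℕ-fromℕ< m<n))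
        (s , (λ _ _ → s-inj) , (λ l → C⊆ _ _ (Equivalence.from (E⇔ _ _) (l , inj₁ (refl , refl)))) ,
         Equivalence.to (E⇔ _ _) ab , Equivalence.to (E⇔ _ _) cd)
      where
      m<n : m < n
      m<n = ℕ.≤-trans (ℕ.m≤n+m (suc m) 2) (injective⇒≤ s-inj)

-- Orienting the components

Oriented : (Fin n → Fin n → Bool) → Fin n → Fin n → Set
Oriented o u v = (o u v ≡ true × o v u ≡ false) ⊎ (o u v ≡ false × o v u ≡ true)

oriented-resp : (o o′ : Fin n → Fin n → Bool) → o u v ≡ o′ u v → o v u ≡ o′ v u →
                Oriented o′ u v → Oriented o u v
oriented-resp o o′ e e′ (inj₁ (p , q)) = inj₁ (trans e p , trans e′ q)
oriented-resp o o′ e e′ (inj₂ (p , q)) = inj₂ (trans e p , trans e′ q)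

CoherentOn : (Fin n → Fin n → Bool) → (Fin (suc k) → Fin n) → Set
CoherentOn o c = (∀ i → o (c i) (c (next i)) ≡ true) ⊎ (∀ i → o (c (next i)) (c i) ≡ true)

coherent-resp : (o o′ : Fin n → Fin n → Bool) {c : Fin (suc k) → Fin n} →
                (∀ i → o (c i) (c (next i)) ≡ o′ (c i) (c (next i))) →
                (∀ i → o (c (next i)) (c i) ≡ o′ (c (next i)) (c i)) →
                CoherentOn o′ c → CoherentOn o c
coherent-resp o o′ e e′ (inj₁ fwd) = inj₁ λ i → trans (e i) (fwd i)
coherent-resp o o′ e e′ (inj₂ bwd) = inj₂ λ i → trans (e′ i) (bwd i)

-- Since `H` is induced on its chordless cycles, these are also chordless in `G`, and the same `o`
-- serves.
cyclic-restrict : (G H : Graph n) → (∀ {u v} → Adj H u v → Adj G u v) →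
                  (∀ {m} {c : Fin (3 + m) → Fin n} → IsChordlessCycle H c →
                     ∀ i j → Adj G (c i) (c j) → Adj H (c i) (c j)) →
                  CyclicallyOrientable G → CyclicallyOrientable H
cyclic-restrict G H H⊆G induced (o , or , cyc) = o , (λ u v → or u v ∘ H⊆G) ,
  λ m c ch@(c-inj , edges , chordless) →
    cyc m c (c-inj , H⊆G ∘ edges , λ i j → chordless i j ∘ induced ch i j)

cyclic-reverse : (G : Graph n) → ∀ {o} → IsCyclicOrientation G o → IsCyclicOrientation G (λ u v → o v u)
cyclic-reverse G (or , cyc) = (λ u v → or v u ∘ adj-sym G) , λ m c → Sum.swap ∘ cyc m c

-- An edge of `G` between two vertices of a cycle in `K` is equivalent to an edge of that cycle,
-- hence belongs to `K` by transitivity.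
component-cyclic : (G K : Graph n) → IsTwoConnComponent G K →
                   CyclicallyOrientable G → CyclicallyOrientable K
component-cyclic G K (a , b , a~b , E⇔ , _) = cyclic-restrict G K (proj₁ ∘ Equivalence.to (E⇔ _ _)) induced
  where
  induced : ∀ {m} {c : Fin (3 + m) → Fin _} → IsChordlessCycle K c →
            ∀ i j → Adj G (c i) (c j) → Adj K (c i) (c j)
  induced {c = c} (c-inj , edges , _) i j ci~cj = Equivalence.from (E⇔ _ _)
    (ci~cj , equiv-trans G ci~cj (G-edges i) a~b
      (linkage⇒equiv G ci~cj (G-edges i) (chord-linkage {G = G} c-inj G-edges i j (adj⇒≢ G ci~cj ∘ cong c)))
      (proj₂ (Equivalence.to (E⇔ _ _) (edges i))))
    where
    G-edges : ∀ i → Adj G (c i) (c (next i))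
    G-edges i = proj₁ (Equivalence.to (E⇔ _ _) (edges i))

module _ (G : Graph n) where

  InClass : Fin n → Fin n → Fin n → Fin n → Set
  InClass a b u v = Adj G u v × EdgeEquiv G u v a b

  inClass? : ∀ a b u v → Dec (InClass a b u v)
  inClass? a b u v = adj? G u v ×-dec edgeEquiv? G u v a b

  inClass-sym : InClass a b u v → InClass a b v u
  inClass-sym (u~v , eq) = adj-sym G u~v , equiv-flipˡ G eq

  component : Fin n → Fin n → Graph n
  component a b = decGraph {P = λ u → ∃ (InClass a b u)} {Q = InClass a b}
    (λ u → any? (inClass? a b u)) (inClass? a b) inClass-sym (λ (u~u , _) → adj⇒≢ G u~u refl) (_ ,_)

  component-adj : ∀ a b u v → Adj (component a b) u v ⇔ InClass a b u v
  component-adj a b u v = does⇔ (inClass? a b u v)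

  component-isComponent : Adj G a b → IsTwoConnComponent G (component a b)
  component-isComponent {a} {b} a~b = a , b , a~b , component-adj a b , onV
    where
    onV : ∀ u → (V (component a b) u ≡ true) ⇔ (∃[ v ] Adj (component a b) u v)
    onV u = mk⇔
      (λ e → let v , q = Equivalence.to (does⇔ (any? (inClass? a b u))) e in
             v , Equivalence.from (component-adj a b u v) q)
      (λ (v , q) → E-V (component a b) u v q)

  module _ (H : (K : Graph n) → IsTwoConnComponent G K → CyclicallyOrientable K) where

    classOrientation : Fin n → Fin n → Fin n → Fin n → Bool
    classOrientation a b with adj? G a b
    ... | yes a~b = proj₁ (H (component a b) (component-isComponent a~b))
    -- An arbitrary value: `orient` consults only pairs that are edges.
    ... | no _    = λ _ _ → false

    classOrientation-cyclic : Adj G a b → IsCyclicOrientation (component a b) (classOrientation a b)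
    classOrientation-cyclic {a} {b} a~b with adj? G a b
    ... | yes a~b′ = proj₂ (H (component a b) (component-isComponent a~b′))
    ... | no ¬a~b  = contradiction a~b ¬a~b

    hit? : ∀ a b u v → Dec (Adj G a b × EdgeEquiv G u v a b)
    hit? a b u v = adj? G a b ×-dec edgeEquiv? G u v a b

    -- Equivalent edges are oriented by the same component, that of the first pair in the list
    -- which is an edge equivalent to them.
    orient : List (Fin n × Fin n) → Fin n → Fin n → Bool
    orient []             u v = false
    orient ((a , b) ∷ ps) u v =
      if does (hit? a b u v) then classOrientation a b u v else orient ps u v

    orient-hit : ∀ ps → Adj G a b × EdgeEquiv G u v a b →
                 orient ((a , b) ∷ ps) u v ≡ classOrientation a b u v
    orient-hit {a} {b} {u} {v} ps h rewrite dec-true (hit? a b u v) h = refl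

    orient-miss : ∀ ps → ¬ (Adj G a b × EdgeEquiv G u v a b) →
                  orient ((a , b) ∷ ps) u v ≡ orient ps u v
    orient-miss {a} {b} {u} {v} ps ¬h rewrite dec-false (hit? a b u v) ¬h = refl

    orient-oriented : ∀ ps → Adj G u v → (u , v) ∈ ps → Oriented (orient ps) u v
    orient-oriented {u} {v} ((a , b) ∷ ps) u~v uv∈ with hit? a b u v
    ... | yes (a~b , eq) = oriented-resp (orient ((a , b) ∷ ps)) (classOrientation a b)
      (orient-hit ps (a~b , eq)) (orient-hit ps (a~b , equiv-flipˡ G eq))
      (proj₁ (classOrientation-cyclic a~b) u v (Equivalence.from (component-adj a b u v) (u~v , eq)))
    ... | no ¬h = oriented-resp (orient ((a , b) ∷ ps)) (orient ps)
      (orient-miss ps ¬h) (orient-miss ps λ (a~b , eq) → ¬h (a~b , equiv-flipˡ G eq))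
      (orient-oriented ps u~v (case uv∈ of λ
        -- An edge is equivalent to itself, so its own pair would have been a hit; the list cannot
        -- run out first.
        { (here refl) → contradiction (u~v , inj₁ (inj₁ (refl , refl))) ¬h
        ; (there uv∈) → uv∈ }))

    module _ {c : Fin (3 + m) → Fin n} (ch : IsChordlessCycle G c) where

      private
        c-inj = proj₁ ch
        edges = proj₁ (proj₂ ch)
        chordless = proj₂ (proj₂ ch)

        edges-equiv : ∀ i j → EdgeEquiv G (c i) (c (next i)) (c j) (c (next j))
        edges-equiv i j = inj₂ (cycleGraph c c-inj , cycleGraph-⊆ c c-inj {G = G} edges ,
          cycleGraph-isCycle c c-inj , on i , on j)
          where
          on : ∀ i → Adj (cycleGraph c c-inj) (c i) (c (next i))
          on i = Equivalence.from (does⇔ (consecutive? c _ _)) (i , inj₁ (refl , refl))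

      -- All edges of the cycle are equivalent, so the first pair that hits one of them hits all.
      -- The cycle lies in that component, is chordless there, and is oriented by it as a whole.
      orient-coherent : ∀ ps → (c zero , c (next zero)) ∈ ps → CoherentOn (orient ps) c
      orient-coherent ((a , b) ∷ ps) c₀∈ with hit? a b (c zero) (c (next zero))
      ... | yes (a~b , eq) = coherent-resp (orient ((a , b) ∷ ps)) (classOrientation a b)
        (λ i → orient-hit ps (a~b , eqs i))
        (λ i → orient-hit ps (a~b , equiv-flipˡ G (eqs i)))
        (proj₂ (classOrientation-cyclic a~b) _ c (c-inj ,
          (λ i → Equivalence.from (component-adj a b _ _) (edges i , eqs i)) ,
          (λ i j → chordless i j ∘ proj₁ ∘ Equivalence.to (component-adj a b _ _))))
        where
        eqs : ∀ i → EdgeEquiv G (c i) (c (next i)) a b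
        eqs i = equiv-trans G (edges i) (edges zero) a~b (edges-equiv i zero) eq
      ... | no ¬h = coherent-resp (orient ((a , b) ∷ ps)) (orient ps)
        (λ i → orient-miss ps (miss i)) (λ i → orient-miss ps λ (a~b , eq) → miss i (a~b , equiv-flipˡ G eq))
        (orient-coherent ps (case c₀∈ of λ
          { (here refl) → contradiction (edges zero , inj₁ (inj₁ (refl , refl))) ¬h
          ; (there c₀∈) → c₀∈ }))
        where
        miss : ∀ i → ¬ (Adj G a b × EdgeEquiv G (c i) (c (next i)) a b)
        miss i (a~b , eq) = ¬h (a~b , equiv-trans G (edges zero) (edges i) a~b (edges-equiv zero i) eq)

    components-cyclic : CyclicallyOrientable G
    components-cyclic = orient allPairs , (λ u v u~v → orient-oriented allPairs u~v (mem u v)) ,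
      λ m c ch → orient-coherent ch allPairs (mem _ _)
      where
      allPairs = cartesianProduct (allFin n) (allFin n)
      mem : ∀ u v → (u , v) ∈ allPairs
      mem u v = ∈-cartesianProduct⁺ (∈-allFin u) (∈-allFin v)

-- Gluing along an edge

next-next-≢ : (i : Fin (3 + k)) → next (next i) ≢ i
next-next-≢ {k} i eq = case at-distinct {c = id} id (toℕ i) (s<s (s<s z<s)) z<s (begin
  at id (2 + toℕ i)              ≡⟨ at-next id (suc (toℕ i)) ⟨
  next (suc (toℕ i) mod (3 + k)) ≡⟨ cong next (at-suc-toℕ id i) ⟩
  next (next i)                  ≡⟨ eq ⟩
  i                              ≡⟨ at-toℕ id i ⟨
  at id (0 + toℕ i)              ∎) of λ ()
  where open ≡-Reasoning

next-induction : (P : Fin (suc k) → Set) (i : Fin (suc k)) → P i → (∀ {j} → P j → P (next j)) → ∀ j → P j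
next-induction {k} P i pi hereditary j with at-covers id j (toℕ i)
... | s , _ , eq = subst P eq (go s)
  where
  go : ∀ s → P (at id (s + toℕ i))
  go zero    = subst P (sym (at-toℕ id i)) pi
  go (suc s) = subst P (at-next id (s + toℕ i)) (hereditary (go s))

∨-split : ∀ x {y} → x ∨ y ≡ true → x ≡ true ⊎ y ≡ true
∨-split true  _ = inj₁ refl
∨-split false e = inj₂ e

∨-join : ∀ {x y} → x ≡ true ⊎ y ≡ true → x ∨ y ≡ true
∨-join {x = true}  _            = refl
∨-join {x = false} (inj₂ refl) = refl

true-⇔ : ∀ {x y} → (x ≡ true → y ≡ true) → (y ≡ true → x ≡ true) → x ≡ y
true-⇔ {true}  {y}     f g = sym (f refl)
true-⇔ {false} {false} f g = refl
true-⇔ {false} {true}  f g = g refl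

module Decomposition (G G′ C : Graph n) (dec : IsCycleDecomposition G G′ C) where

  private
    G′⊆ : ∀ {u v} → Adj G′ u v → Adj G u v
    G′⊆ = proj₂ (proj₁ dec) _ _
    isCycle = proj₁ (proj₂ (proj₂ dec))
    V-∪ = proj₁ (proj₂ (proj₂ (proj₂ dec)))
    E-∪ = proj₁ (proj₂ (proj₂ (proj₂ (proj₂ dec))))
    meet = proj₂ (proj₂ (proj₂ (proj₂ (proj₂ dec))))
    s = proj₁ (proj₂ isCycle)
    s-inj = proj₁ (proj₂ (proj₂ isCycle))
    V⇔ = proj₁ (proj₂ (proj₂ (proj₂ isCycle)))
    E⇔ = proj₂ (proj₂ (proj₂ (proj₂ isCycle)))
    size = proj₁ isCycle

    adj-split : Adj G u v → Adj G′ u v ⊎ Adj C u v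
    adj-split {u} {v} u~v = ∨-split (E G′ u v) (trans (sym (E-∪ u v)) u~v)

    C⊆ : Adj C u v → Adj G u v
    C⊆ = proj₂ (proj₁ (proj₂ dec)) _ _

  -- An edge of `C` with both ends in `G′` has its ends in the intersection, so it is the shared
  -- edge, which lies in `G′`.
  induced : V G′ u ≡ true → V G′ v ≡ true → Adj G u v → Adj G′ u v
  induced {u} {v} u∈ v∈ u~v with adj-split u~v
  ... | inj₁ e = e
  ... | inj₂ e with meet
  ...   | a , b , a~b , _ , V∩ , _
    with Equivalence.to (V∩ u) (u∈ , adj-V C e) | Equivalence.to (V∩ v) (v∈ , adj-V C (adj-sym C e))
  ...     | inj₁ refl | inj₁ refl = contradiction refl (adj⇒≢ G u~v)
  ...     | inj₁ refl | inj₂ refl = a~b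
  ...     | inj₂ refl | inj₁ refl = adj-sym G′ a~b
  ...     | inj₂ refl | inj₂ refl = contradiction refl (adj⇒≢ G u~v)

  unglue : CyclicallyOrientable G → CyclicallyOrientable G′
  unglue = cyclic-restrict G G′ G′⊆ λ (_ , edges , _) i j →
    induced (adj-V G′ (edges i)) (adj-V G′ (edges j))

  -- The normalized situation: the shared edge is the one at `i`, and `o′` directs it the way `s`
  -- runs. `glue` arrives here by swapping the ends of the edge and by reversing `o′` where
  -- necessary.
  module Glue (i : Fin (3 + size))
              (V∩ : ∀ {u} → V G′ u ≡ true → V C u ≡ true → u ≡ s i ⊎ u ≡ s (next i))
              (E∩ : ∀ {u v} → Adj G′ u v → Adj C u v →
                    (u ≡ s i × v ≡ s (next i)) ⊎ (u ≡ s (next i) × v ≡ s i))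
              (edge∩ : Adj G′ (s i) (s (next i)))
              (o′ : Fin n → Fin n → Bool) (cyc′ : IsCyclicOrientation G′ o′)
              (o′-edge : o′ (s i) (s (next i)) ≡ true) where

    private
      K = 3 + size

      Succ : Fin n → Fin n → Set
      Succ u v = ∃[ j ] (s j ≡ u × s (next j) ≡ v)

      succ? : ∀ u v → Dec (Succ u v)
      succ? u v = any? λ j → (s j Fin.≟ u) ×-dec (s (next j) Fin.≟ v)

    -- `C` is oriented around `s`. On the shared edge this agrees with `o′` by `o′-edge`, so letting
    -- `C` take precedence leaves `o′` intact on `G′`.
    o : Fin n → Fin n → Bool
    o u v = if E C u v then does (succ? u v) else o′ u v

    private
      C-edge : ∀ j → Adj C (s j) (s (next j))
      C-edge j = Equivalence.from (E⇔ _ _) (j , inj₁ (refl , refl))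

      o-fwd : ∀ j → o (s j) (s (next j)) ≡ true
      o-fwd j rewrite C-edge j = dec-true (succ? _ _) (j , refl , refl)

      o-bwd : ∀ j → o (s (next j)) (s j) ≡ false
      o-bwd j rewrite adj-sym C (C-edge j) = dec-false (succ? _ _)
        λ (l , p , q) → next-next-≢ j (s-inj (trans (cong (s ∘ next) (sym (s-inj p))) q))

      o-old : Adj G′ u v → o u v ≡ o′ u v
      o-old {u} {v} u~v with E C u v in e
      ... | false = refl
      ... | true with E∩ u~v e
      ...   | inj₁ (refl , refl) = trans (dec-true (succ? _ _) (i , refl , refl)) (sym o′-edge)
      ...   | inj₂ (refl , refl) = trans
        (dec-false (succ? _ _) λ (l , p , q) →
          next-next-≢ i (s-inj (trans (cong (s ∘ next) (sym (s-inj p))) q)))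
        (case proj₁ cyc′ _ _ edge∩ of λ
          { (inj₁ (_ , f)) → sym f
          ; (inj₂ (f , _)) → case trans (sym o′-edge) f of λ () })

      o-oriented : ∀ u v → Adj G u v → Oriented o u v
      o-oriented u v u~v with adj-split u~v
      ... | inj₁ e = oriented-resp o o′ (o-old e) (o-old (adj-sym G′ e)) (proj₁ cyc′ u v e)
      ... | inj₂ e with Equivalence.to (E⇔ u v) e
      ...   | j , inj₁ (refl , refl) = inj₁ (o-fwd j , o-bwd j)
      ...   | j , inj₂ (refl , refl) = inj₂ (o-bwd j , o-fwd j)

      module _ {c : Fin (3 + l) → Fin n} (ch : IsChordlessCycle G c) where

        c-inj = proj₁ ch
        edges = proj₁ (proj₂ ch)
        chordless = proj₂ (proj₂ ch)

        On : Fin n → Set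
        On u = ∃[ t ] c t ≡ u

        inside : (∀ t → V G′ (c t) ≡ true) → CoherentOn o c
        inside in′ = coherent-resp o o′ (λ t → o-old (edges′ t)) (λ t → o-old (adj-sym G′ (edges′ t)))
          (proj₂ cyc′ _ c (c-inj , edges′ , λ t t′ → chordless t t′ ∘ G′⊆))
          where
          edges′ : ∀ t → Adj G′ (c t) (c (next t))
          edges′ t = induced (in′ t) (in′ (next t)) (edges t)

        neighbours : ∀ {j v} → V G′ (s j) ≢ true → Adj G (s j) v → v ≡ s (next j) ⊎ v ≡ s (prev j)
        neighbours {j} ¬in j~v with adj-split j~v
        ... | inj₁ e = contradiction (adj-V G′ e) ¬in
        ... | inj₂ e with Equivalence.to (E⇔ _ _) e
        ...   | r , inj₁ (p , refl) = inj₁ (cong (s ∘ next) (s-inj p))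
        ...   | r , inj₂ (p , refl) = inj₂ (cong s (next-injective (trans (s-inj p) (sym (next-prev j)))))

        next≢prev : ∀ {t} → c (next t) ≢ c (prev t)
        next≢prev {t} eq = next-next-≢ t (trans (cong next (c-inj eq)) (next-prev t))

        spread : ∀ {j} → V G′ (s j) ≢ true → On (s j) → On (s (next j)) × On (s (prev j))
        spread {j} ¬in (t , ct≡)
          with neighbours ¬in (subst (λ x → Adj G x (c (next t))) ct≡ (edges t))
             | neighbours ¬in (subst₂ (λ x y → Adj G x (c y)) (trans (cong c (next-prev t)) ct≡) refl
                                      (adj-sym G (edges (prev t))))
        ... | inj₁ p | inj₁ q = ⊥-elim (next≢prev (trans p (sym q)))
        ... | inj₁ p | inj₂ q = (next t , p) , (prev t , q)
        ... | inj₂ p | inj₁ q = (prev t , q) , (next t , p)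
        ... | inj₂ p | inj₂ q = ⊥-elim (next≢prev (trans p (sym q)))

        -- The ring starts at the shared edge, whose ends get offsets 0 and 1; the offsets from 2 to
        -- `K - 1` lie outside `G′`.
        x₀ = toℕ i
        ring : ℕ → Fin n
        ring r = at s (r + x₀)

        interior : ∀ {r} → 2 ≤ r → r < K → V G′ (ring r) ≢ true
        interior {r} 2≤r r<K in′ with V∩ in′ (Equivalence.from (V⇔ _) (_ , refl))
        ... | inj₁ eq = case at-distinct s-inj x₀ r<K z<s (trans eq (sym (at-toℕ s i))) of
          λ { refl → case 2≤r of λ () }
        ... | inj₂ eq = case at-distinct s-inj x₀ r<K (s<s z<s) (trans eq (sym (at-suc-toℕ s i))) of
          λ { refl → case 2≤r of λ { (s≤s ()) } }

        -- The bound admits `r′ = K`, which is offset 0 one period later; this is how `s i` is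
        -- reached from above.
        spread-up : ∀ {r r′} → r ≤′ r′ → 2 ≤ r → r′ ≤ K → On (ring r) → On (ring r′)
        spread-up ≤′-refl _ _ on = on
        spread-up (≤′-step {r′} r≤) 2≤r r′<K on = subst On (at-next s (r′ + x₀))
          (proj₁ (spread (interior (ℕ.≤-trans 2≤r (ℕ.≤′⇒≤ r≤)) r′<K) (spread-up r≤ 2≤r (ℕ.<⇒≤ r′<K) on)))

        spread-down : ∀ {r r′} → r′ ≤′ r → 1 ≤ r′ → r < K → On (ring r) → On (ring r′)
        spread-down ≤′-refl _ _ on = on
        spread-down (≤′-step {r} r′≤) 1≤r′ r<K on = spread-down r′≤ 1≤r′ (ℕ.<-trans (ℕ.n<1+n r) r<K)
          (subst On (cong s (next-injective (trans (next-prev _) (sym (next-mod (r + x₀))))))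
            (proj₂ (spread (interior (s≤s (ℕ.≤-trans 1≤r′ (ℕ.≤′⇒≤ r′≤))) r<K) on)))

        all-on : ∀ {r} → 2 ≤ r → r < K → On (ring r) → ∀ j → On (s j)
        all-on {r} 2≤r r<K on j with at-covers s j x₀
        ... | zero , _ , eq = subst On (trans (at-period s x₀) eq)
          (spread-up (ℕ.≤⇒≤′ (ℕ.<⇒≤ r<K)) 2≤r ℕ.≤-refl on)
        ... | suc r′ , r′<K , eq with ℕ.≤-total (suc r′) r
        ...   | inj₁ r′≤r = subst On eq (spread-down (ℕ.≤⇒≤′ r′≤r) (s≤s z≤n) r<K on)
        ...   | inj₂ r≤r′ = subst On eq (spread-up (ℕ.≤⇒≤′ r≤r′) 2≤r (ℕ.<⇒≤ r′<K) on)

        Fwd Bwd : Fin (3 + l) → Set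
        Fwd t = ∃[ j ] c t ≡ s j × c (next t) ≡ s (next j)
        Bwd t = ∃[ j ] c t ≡ s (next j) × c (next t) ≡ s j

        -- By `all-on` the whole of `C` lies on `c`, and chordlessness makes neighbours on `C`
        -- consecutive on `c`. So `c` runs around `C` in one direction, along which `o` is coherent.
        outside : ∀ {t} → V G′ (c t) ≢ true → CoherentOn o c
        outside {t} ¬in with Equivalence.to (V⇔ (c t)) V-C
          where
          V-C : V C (c t) ≡ true
          V-C = [ (λ e → contradiction e ¬in) , id ]′
            (∨-split (V G′ (c t)) (trans (sym (V-∪ (c t))) (adj-V G (edges t))))
        ... | j , sj≡ct with at-covers s j x₀
        ...   | r , r<K , ring≡ = result
          where
          ∉G′ : ∀ {u} → s j ≡ u → V G′ u ≢ true
          ∉G′ eq in′ = ¬in (subst (λ u → V G′ u ≡ true) (trans (sym eq) sj≡ct) in′)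

          2≤r : 2 ≤ r
          2≤r = ℕ.≤∧≢⇒< (ℕ.≤∧≢⇒< z≤n
            λ { refl → ∉G′ (trans (sym ring≡) (at-toℕ s i)) (adj-V G′ edge∩) })
            λ { refl → ∉G′ (trans (sym ring≡) (at-suc-toℕ s i)) (adj-V G′ (adj-sym G′ edge∩)) }

          on : ∀ j → On (s j)
          on = all-on 2≤r r<K (t , sym (trans ring≡ sj≡ct))

          -- The vertex after `s (next j)` is a cyclic neighbour of `c (next t)` on `c`. It differs
          -- from `c t`, as the cycle has at least three vertices, so it comes next.
          fwd-step : ∀ {t} → Fwd t → Fwd (next t)
          fwd-step {t} (j , p , q) with on (next (next j))
          ... | t′ , e with chordless (next t) t′ (subst₂ (Adj G) (sym q) (sym e) (C⊆ (C-edge (next j))))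
          ...   | inj₁ refl = next j , q , e
          ...   | inj₂ eq = contradiction
            (s-inj (trans (sym e) (trans (cong c (sym (next-injective eq))) p))) (next-next-≢ j)

          bwd-step : ∀ {t} → Bwd t → Bwd (next t)
          bwd-step {t} (j , p , q) with on (prev j)
          ... | t′ , e with chordless (next t) t′
                              (subst₂ (Adj G) (trans (cong s (next-prev j)) (sym q)) (sym e)
                                (C⊆ (adj-sym C (C-edge (prev j)))))
          ...   | inj₁ refl = prev j , trans q (cong s (sym (next-prev j))) , e
          ...   | inj₂ eq = contradiction
            (trans (cong next (s-inj (trans (sym p) (trans (cong c (next-injective eq)) e)))) (next-prev j))
            (next-next-≢ j)

          result : CoherentOn o c
          result with on (next j)
          ... | t′ , e with chordless t t′ (subst₂ (Adj G) sj≡ct (sym e) (C⊆ (C-edge j)))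
          ...   | inj₁ refl = inj₁ λ t″ →
            let j′ , p , q = next-induction Fwd t (j , sym sj≡ct , e) fwd-step t″ in
            subst₂ (λ x y → o x y ≡ true) (sym p) (sym q) (o-fwd j′)
          ...   | inj₂ refl = inj₂ λ t″ →
            let j′ , p , q = next-induction Bwd t′ (j , e , sym sj≡ct) bwd-step t″ in
            subst₂ (λ x y → o x y ≡ true) (sym q) (sym p) (o-fwd j′)

    glued : IsCyclicOrientation G o
    glued = o-oriented , λ l c ch → case all? (λ t → V G′ (c t) Bool.≟ true) of λ
      { (yes in′) → inside ch in′
      ; (no ¬in)  → let t , ¬in′ = Fin.¬∀⟶∃¬ _ _ (λ t → V G′ (c t) Bool.≟ true) ¬in in outside ch ¬in′ }

  glue : CyclicallyOrientable G′ → CyclicallyOrientable G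
  glue (o′ , cyc′) with meet
  ... | a , b , a~b , ab∈C , V∩ , E∩ with Equivalence.to (E⇔ a b) ab∈C
  ...   | i , inj₁ (refl , refl) = oriented-along (proj₁ cyc′ _ _ a~b)
    where
    oriented-along : Oriented o′ (s i) (s (next i)) → CyclicallyOrientable G
    oriented-along (inj₁ (e , _)) = _ , Glue.glued i
      (λ p q → Equivalence.to (V∩ _) (p , q)) (λ p q → E∩ _ _ (p , q)) a~b o′ cyc′ e
    oriented-along (inj₂ (_ , e)) = _ , Glue.glued i
      (λ p q → Equivalence.to (V∩ _) (p , q)) (λ p q → E∩ _ _ (p , q)) a~b
      (λ u v → o′ v u) (cyclic-reverse G′ cyc′) e
  ...   | i , inj₂ (refl , refl) = oriented-along (proj₁ cyc′ _ _ a~b)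
    where
    oriented-along : Oriented o′ (s (next i)) (s i) → CyclicallyOrientable G
    oriented-along (inj₂ (_ , e)) = _ , Glue.glued i
      (λ p q → Sum.swap (Equivalence.to (V∩ _) (p , q))) (λ p q → Sum.swap (E∩ _ _ (p , q)))
      (adj-sym G′ a~b) o′ cyc′ e
    oriented-along (inj₁ (e , _)) = _ , Glue.glued i
      (λ p q → Sum.swap (Equivalence.to (V∩ _) (p , q))) (λ p q → Sum.swap (E∩ _ _ (p , q)))
      (adj-sym G′ a~b) (λ u v → o′ v u) (cyclic-reverse G′ cyc′) e

-- Splitting off a cycle

module _ {P : Fin n → Set} (P? : ∀ u → Dec (P u)) where

  subset : Subset n
  subset = tabulate (does ∘ P?)

  ∈-subset⁺ : P u → u ∈ₛ subset
  ∈-subset⁺ {u} pu = lookup⇒[]= u subset (trans (lookup∘tabulate (does ∘ P?) u) (dec-true (P? u) pu))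

  ∈-subset⁻ : u ∈ₛ subset → P u
  ∈-subset⁻ {u} u∈ = Equivalence.to (does⇔ (P? u))
    (trans (sym (lookup∘tabulate (does ∘ P?) u)) ([]=⇒lookup u∈))

module _ {G : Graph n} {D : Subset n} {a b : Fin n} (a∉ : a ∉ₛ D)
         (closed : ∀ {u v} → u ∈ₛ D → Adj G u v → v ∈ₛ D ⊎ v ≡ a ⊎ v ≡ b) where

  -- The only ways out of `D` are `a` and `b`, and the walk never visits `b`; hence it leaves `D` by
  -- a step to `a`.
  exit : ∀ {S : Fin n → Set} {d} → ¬ S b → d ∈ₛ D → Walk G S d a →
         ∃[ p ] p ∈ₛ D × Walk G (_∈ₛ D) d p × Adj G p a
  exit _ d∈ (stop _) = contradiction d∈ a∉
  exit b∉S d∈ (step _ d~v r) with closed d∈ d~v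
  ... | inj₂ (inj₁ refl) = _ , d∈ , stop d∈ , d~v
  ... | inj₂ (inj₂ refl) = contradiction (walk-start r) b∉S
  ... | inj₁ v∈ with exit b∉S v∈ r
  ...   | p , p∈ , v→p , p~a = p , p∈ , step d∈ d~v v→p , p~a

-- Of the two disjoint walks, each avoids the end of the other, so each leaves `D` next to its own
-- end. Inside `D` they are joined through `d`.
crossing : ∀ {G : Graph n} {D : Subset n} {a b d d′} → a ∉ₛ D → b ∉ₛ D →
           (∀ {u v} → u ∈ₛ D → Adj G u v → v ∈ₛ D ⊎ v ≡ a ⊎ v ≡ b) →
           d ∈ₛ D → Adj G d d′ → Linkage G d d′ a b →
           ∃[ p ] ∃[ q ] p ∈ₛ D × q ∈ₛ D × Adj G p a × Adj G q b × Walk G (_∈ₛ D) p q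
crossing {G = G} a∉ b∉ closed d∈ d~d′ (S , T , d→a , d′→b , S#T)
  with exit {G = G} a∉ closed (λ b∈S → S#T b∈S (walk-end d′→b)) d∈ d→a | closed d∈ d~d′
... | p , p∈ , d→p , p~a | inj₂ (inj₁ refl) = ⊥-elim (S#T (walk-end d→a) (walk-start d′→b))
... | p , p∈ , d→p , p~a | inj₂ (inj₂ refl) = p , _ , p∈ , d∈ , p~a , d~d′ , walk-reverse d→p
... | p , p∈ , d→p , p~a | inj₁ d′∈
  with exit {G = G} b∉ (λ u∈ u~v → Sum.map₂ Sum.swap (closed u∈ u~v)) (S#T (walk-end d→a)) d′∈ d′→b
...   | q , q∈ , d′→q , q~b = p , q , p∈ , q∈ , p~a , q~b , walk-reverse d→p ++ʷ step d∈ d~d′ d′→q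

ends : ∀ (G : Graph n) {a b u v} → Adj G u v → u ≡ a ⊎ u ≡ b → v ≡ a ⊎ v ≡ b →
       (u ≡ a × v ≡ b) ⊎ (u ≡ b × v ≡ a)
ends G u~v (inj₁ refl) (inj₁ refl) = contradiction refl (adj⇒≢ G u~v)
ends G u~v (inj₁ p)    (inj₂ q)    = inj₁ (p , q)
ends G u~v (inj₂ p)    (inj₁ q)    = inj₂ (p , q)
ends G u~v (inj₂ refl) (inj₂ refl) = contradiction refl (adj⇒≢ G u~v)

CycleSplit : Graph n → Set
CycleSplit {n} G = Σ[ G′ ∈ Graph n ] Σ[ C ∈ Graph n ] IsCycleDecomposition G G′ C

module _ (G : Graph n) where

  delete : Subset n → Graph n
  delete D = decGraph {P = λ u → V G u ≡ true × u ∉ₛ D} {Q = λ u v → Adj G u v × u ∉ₛ D × v ∉ₛ D}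
    (λ u → (V G u Bool.≟ true) ×-dec ¬? (u ∈? D))
    (λ u v → adj? G u v ×-dec ¬? (u ∈? D) ×-dec ¬? (v ∈? D))
    (λ (u~v , u∉ , v∉) → adj-sym G u~v , v∉ , u∉)
    (λ (u~u , _) → adj⇒≢ G u~u refl)
    (λ (u~v , u∉ , _) → adj-V G u~v , u∉)

  delete-V : ∀ {D u} → V (delete D) u ≡ true ⇔ (V G u ≡ true × u ∉ₛ D)
  delete-V {D} {u} = does⇔ ((V G u Bool.≟ true) ×-dec ¬? (u ∈? D))

  delete-adj : ∀ {D u v} → Adj (delete D) u v ⇔ (Adj G u v × u ∉ₛ D × v ∉ₛ D)
  delete-adj {D} {u} {v} = does⇔ (adj? G u v ×-dec ¬? (u ∈? D) ×-dec ¬? (v ∈? D))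

  -- D is the interior of the chordless cycle c, so c can be cut off along the edge a b.
  delete-interior : ∀ {m} {c : Fin (3 + m) → Fin n} → IsChordlessCycle G c → ∀ (D : Subset n) {a b} →
    (∀ {u} → u ∈ₛ D → V G u ≡ true) → Adj G a b → a ∉ₛ D → b ∉ₛ D → ∃[ i ] c i ≡ a → ∃[ j ] c j ≡ b →
    (∀ i → c i ∈ₛ D ⊎ c i ≡ a ⊎ c i ≡ b) → (∀ {u} → u ∈ₛ D → ∃[ i ] c i ≡ u) →
    (∀ {u v} → u ∈ₛ D → Adj G u v → v ∈ₛ D ⊎ v ≡ a ⊎ v ≡ b) → CycleSplit G
  delete-interior {c = c} (c-inj , edges , chordless) D {a} {b} D⊆V a~b a∉ b∉ a-on b-on on⇒ D-on closed =
    delete D , C ,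
    ((λ u e → proj₁ (Equivalence.to delete-V e)) , (λ u v e → proj₁ (Equivalence.to delete-adj e))) ,
    C⊆ , cycleGraph-isCycle c c-inj ,
    (λ u → true-⇔ (V-split u)
      ([ proj₁ ∘ Equivalence.to delete-V , proj₁ C⊆ u ]′ ∘ ∨-split (V (delete D) u))) ,
    (λ u v → true-⇔ (E-split u v)
      ([ proj₁ ∘ Equivalence.to delete-adj , proj₂ C⊆ u v ]′ ∘ ∨-split (E (delete D) u v))) ,
    a , b , Equivalence.from delete-adj (a~b , a∉ , b∉) , C-induced a-on b-on a~b ,
    (λ u → mk⇔ (λ (u∈ , u-on) → meet (proj₂ (Equivalence.to delete-V u∈)) (C-on u-on))
      λ { (inj₁ refl) → Equivalence.from delete-V (adj-V G a~b , a∉) , on-C a-on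
        ; (inj₂ refl) → Equivalence.from delete-V (adj-V G (adj-sym G a~b) , b∉) , on-C b-on }) ,
    λ u v (e , e′) → let u~v , u∉ , v∉ = Equivalence.to delete-adj e in
      ends G u~v (meet u∉ (C-on (adj-V C e′))) (meet v∉ (C-on (adj-V C (adj-sym C e′))))
    where
    C = cycleGraph c c-inj
    C⊆ : C ⊆G G
    C⊆ = cycleGraph-⊆ c c-inj {G = G} edges

    C-on : ∀ {u} → V C u ≡ true → ∃[ i ] c i ≡ u
    C-on {u} = Equivalence.to (does⇔ (any? λ i → c i Fin.≟ u))

    on-C : ∀ {u} → ∃[ i ] c i ≡ u → V C u ≡ true
    on-C {u} = Equivalence.from (does⇔ (any? λ i → c i Fin.≟ u))

    C-induced : ∀ {u v} → ∃[ i ] c i ≡ u → ∃[ j ] c j ≡ v → Adj G u v → Adj C u v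
    C-induced (i , refl) (j , refl) u~v = Equivalence.from (does⇔ (consecutive? c _ _))
      (case chordless i j u~v of λ
        { (inj₁ refl) → i , inj₁ (refl , refl)
        ; (inj₂ refl) → j , inj₂ (refl , refl) })

    meet : ∀ {u} → u ∉ₛ D → ∃[ i ] c i ≡ u → u ≡ a ⊎ u ≡ b
    meet u∉ (i , refl) = [ (λ u∈ → contradiction u∈ u∉) , id ]′ (on⇒ i)

    V-split : ∀ u → V G u ≡ true → V (delete D) u ∨ V C u ≡ true
    V-split u u∈G = ∨-join (case u ∈? D of λ
      { (yes u∈) → inj₂ (on-C (D-on u∈))
      ; (no u∉)  → inj₁ (Equivalence.from delete-V (u∈G , u∉)) })

    near-on : ∀ {u v} → u ∈ₛ D → Adj G u v → ∃[ i ] c i ≡ v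
    near-on u∈ u~v with closed u∈ u~v
    ... | inj₁ v∈          = D-on v∈
    ... | inj₂ (inj₁ refl) = a-on
    ... | inj₂ (inj₂ refl) = b-on

    E-split : ∀ u v → Adj G u v → E (delete D) u v ∨ E C u v ≡ true
    E-split u v u~v = ∨-join (case (u ∈? D) , (v ∈? D) of λ
      { (yes u∈ , _)      → inj₂ (C-induced (D-on u∈) (near-on u∈ u~v) u~v)
      ; (no _   , yes v∈) → inj₂ (C-induced (near-on v∈ (adj-sym G u~v)) (D-on v∈) u~v)
      ; (no u∉  , no v∉)  → inj₁ (Equivalence.from delete-adj (u~v , u∉ , v∉)) })

  module _ {o} (cyc : IsCyclicOrientation G o) (two : TwoConnected G) where

    -- Descent on the part D cut off by the edge a b: a chordless cycle through a b and D either
    -- exhausts D, or leaves over a smaller part cut off by another of its edges.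
    split-behind : ∀ D → Acc _⊂_ D → ∀ {a b d} → Adj G a b → d ∈ₛ D → a ∉ₛ D → b ∉ₛ D →
      (∀ {u} → u ∈ₛ D → V G u ≡ true) →
      (∀ {u v} → u ∈ₛ D → Adj G u v → v ∈ₛ D ⊎ v ≡ a ⊎ v ≡ b) → CycleSplit G
    split-behind D (acc rec) {a} {b} {d} a~b d∈ a∉ b∉ D⊆V closed = through crossed
      where
      crossed : ∃[ p ] ∃[ q ] p ∈ₛ D × q ∈ₛ D × Adj G p a × Adj G q b × Walk G (_∈ₛ D) p q
      -- Two-connectedness puts some edge at `d` on a common cycle with `a b`; its two arcs yield a
      -- walk inside `D` from a neighbour of `a` to a neighbour of `b`.
      crossed with proj₁ (proj₂ two) d (D⊆V d∈)
      ... | d′ , d~d′ with equiv⇒linkage G d~d′ (proj₂ (proj₂ two) d d′ a b d~d′ a~b)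
      ...   | inj₁ link = crossing {G = G} a∉ b∉ closed d∈ d~d′ link
      ...   | inj₂ link
        with crossing {G = G} b∉ a∉ (λ u∈ u~v → Sum.map₂ Sum.swap (closed u∈ u~v)) d∈ d~d′ link
      ...     | q , p , q∈ , p∈ , q~b , p~a , q→p = p , q , p∈ , q∈ , p~a , q~b , walk-reverse q→p

      -- The path from `a` is to end at its only neighbour of `b` in `D`; closed up through `b`, it
      -- then has no chord.
      Exit Inside : Fin n → Set
      Exit u = u ∈ₛ D × Adj G b u
      Inside u = u ∈ₛ D ⊎ u ≡ a

      around : ∀ {y ys} → IPath G Exit a (y ∷ ys) → All Inside (y ∷ ys) → CycleSplit G
      around {y} {ys} ip inW = case any? (λ x → x ∈? D ×-dec ¬? (member? Fin._≟_ x (y ∷ ys))) of λ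
        { (no none) → delete-interior ch D D⊆V a~b a∉ b∉ (suc zero , refl) (zero , refl) on⇒
            (λ {u} u∈ → on-path (decidable-stable (member? Fin._≟_ u (y ∷ ys)) λ u∉ → none (u , u∈ , u∉)))
            closed
        ; (yes (x , x∈ , x∉ys)) → beyond x∈ x∉ys }
        where
        loop : Fin (3 + length ys) → Fin n
        loop = lookup (b ∷ a ∷ y ∷ ys)

        inD : ∀ {x} → x ∈ y ∷ ys → x ∈ₛ D
        inD x∈ = [ id , (λ { refl → contradiction x∈ (ipath-∉ ip) }) ]′ (All.lookup inW x∈)

        b∉path : b ∉ a ∷ y ∷ ys
        b∉path (here refl) = adj⇒≢ G a~b refl
        b∉path (there b∈)  = b∉ (inD b∈)

        ch : IsChordlessCycle G loop
        ch = ipath-cycle ip proj₂ (All.tabulate λ x∈ b~x → inD x∈ , b~x) b∉path (adj-sym G a~b)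

        on⇒ : ∀ i → loop i ∈ₛ D ⊎ loop i ≡ a ⊎ loop i ≡ b
        on⇒ zero          = inj₂ (inj₂ refl)
        on⇒ (suc zero)    = inj₂ (inj₁ refl)
        on⇒ (suc (suc i)) = inj₁ (inD (∈-lookup i))

        on-path : ∀ {x} → x ∈ y ∷ ys → ∃[ i ] loop i ≡ x
        on-path x∈ = suc (suc (Any.index x∈)) , sym (lookup-index x∈)

        beyond : ∀ {x} → x ∈ₛ D → x ∉ y ∷ ys → CycleSplit G
        -- The component of `x` off the loop becomes the new part, and the loop edge where it
        -- attaches replaces `a b`.
        beyond {x} x∈ x∉ys = split-behind B (rec B⊂D) (proj₁ (proj₂ ch) i) d∈B
          (λ ci∈ → avoids ci∈ i refl) (λ ci∈ → avoids ci∈ (next i) refl) (D⊆V ∘ B⊆D)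
          λ u∈ u~v → case B-closed u∈ u~v of λ
            { (inj₁ v∈)         → inj₁ v∈
            ; (inj₂ (j , refl)) → inj₂ (Sum.map (cong loop) (cong loop) (att u∈ j u~v)) }
          where
          x∉cycle : ∀ j → x ≢ loop j
          x∉cycle zero          refl = b∉ x∈
          x∉cycle (suc zero)    refl = a∉ x∈
          x∉cycle (suc (suc j)) refl = x∉ys (∈-lookup j)

          open Bridge (bridge cyc ch x x∉cycle) renaming (closed to B-closed)
          i   = proj₁ attached
          att = proj₂ attached

          -- A walk in `B` could leave `D` only through `a` or `b`, and both lie on the loop that
          -- `B` avoids.
          stays : ∀ {u w} → u ∈ₛ D → Walk G (_∈ₛ B) u w → w ∈ₛ D
          stays u∈ (stop _) = u∈
          stays u∈ (step _ u~v r) with closed u∈ u~v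
          ... | inj₁ v∈          = stays v∈ r
          ... | inj₂ (inj₁ refl) = contradiction refl (avoids (walk-start r) (suc zero))
          ... | inj₂ (inj₂ refl) = contradiction refl (avoids (walk-start r) zero)

          B⊆D : ∀ {u} → u ∈ₛ B → u ∈ₛ D
          B⊆D u∈ = stays x∈ (connected d∈B u∈)

          B⊂D : B ⊂ D
          -- The inclusion is strict because `y` lies in `D` and on the loop.
          B⊂D = B⊆D , y , inD (here refl) , λ y∈ → avoids y∈ (suc (suc zero)) refl

      through : (∃[ p ] ∃[ q ] p ∈ₛ D × q ∈ₛ D × Adj G p a × Adj G q b × Walk G (_∈ₛ D) p q) → CycleSplit G
      through (p , q , p∈ , q∈ , p~a , q~b , p→q)
        with shorten {W = Inside} (λ u → u ∈? D ×-dec adj? G b u)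
               (step (inj₂ refl) (adj-sym G p~a) (walk-map inj₁ p→q)) (q∈ , adj-sym G q~b)
      ... | [] , end (a∈ , _) , _ = contradiction a∈ a∉
      ... | y ∷ ys , ip , _ ∷ inW = around ip inW

    -- The descent starts from an arbitrary edge `a b`, with all the other vertices as `D`. If there
    -- are none, `G` is that edge.
    edge-or-split : IsSingleEdge G ⊎ CycleSplit G
    edge-or-split with proj₁ two
    ... | a , b , a~b with any? (λ d → (V G d Bool.≟ true) ×-dec ¬? (d Fin.≟ a) ×-dec ¬? (d Fin.≟ b))
    ...   | yes (d , rest) = inj₂ (split-behind D (⊂-wellFounded D) a~b (∈-subset⁺ rest? rest)
            (λ a∈ → proj₁ (proj₂ (∈-subset⁻ rest? a∈)) refl) (λ b∈ → proj₂ (proj₂ (∈-subset⁻ rest? b∈)) refl)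
            (proj₁ ∘ ∈-subset⁻ rest?) λ {u} {v} _ u~v → closed v u~v)
      where
      rest? : ∀ d → Dec (V G d ≡ true × d ≢ a × d ≢ b)
      rest? d = (V G d Bool.≟ true) ×-dec ¬? (d Fin.≟ a) ×-dec ¬? (d Fin.≟ b)
      D = subset rest?
      closed : ∀ {u} v → Adj G u v → v ∈ₛ D ⊎ v ≡ a ⊎ v ≡ b
      closed v u~v with v Fin.≟ a | v Fin.≟ b
      ... | yes p | _     = inj₂ (inj₁ p)
      ... | no _  | yes q = inj₂ (inj₂ q)
      ... | no ¬p | no ¬q = inj₁ (∈-subset⁺ rest? (adj-V G (adj-sym G u~v) , ¬p , ¬q))
    ...   | no none = inj₁ (a , b , adj⇒≢ G a~b ,
            (λ u → mk⇔ (is-end u) λ { (inj₁ refl) → adj-V G a~b ; (inj₂ refl) → adj-V G (adj-sym G a~b) }) ,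
            (λ u v → mk⇔ (λ u~v → ends G u~v (is-end u (adj-V G u~v)) (is-end v (adj-V G (adj-sym G u~v))))
              λ { (inj₁ (refl , refl)) → a~b ; (inj₂ (refl , refl)) → adj-sym G a~b }))
      where
      is-end : ∀ u → V G u ≡ true → u ≡ a ⊎ u ≡ b
      is-end u u∈ = decidable-stable ((u Fin.≟ a) ⊎-dec (u Fin.≟ b)) λ neither →
        none (u , u∈ , neither ∘ inj₁ , neither ∘ inj₂)

-- Single edges and cycles

singleEdge-cyclic : (G : Graph n) → IsSingleEdge G → CyclicallyOrientable G
singleEdge-cyclic G (a , b , a≢b , V⇔ , E⇔) = (λ u _ → does (u Fin.≟ a)) , oriented ,
  -- Three distinct vertices do not fit on two ends, so there is no cycle to check.
  λ m c (c-inj , edges , _) →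
    let on-ends = λ i → Equivalence.to (V⇔ (c i)) (adj-V G (edges i)) in
    ⊥-elim (too-many c-inj (on-ends zero) (on-ends (suc zero)) (on-ends (suc (suc zero))))
  where
  oriented : IsOrientation G (λ u _ → does (u Fin.≟ a))
  oriented u v u~v with Equivalence.to (E⇔ u v) u~v
  ... | inj₁ (refl , refl) = inj₁ (dec-true (a Fin.≟ a) refl , dec-false (b Fin.≟ a) (a≢b ∘ sym))
  ... | inj₂ (refl , refl) = inj₂ (dec-false (b Fin.≟ a) (a≢b ∘ sym) , dec-true (a Fin.≟ a) refl)

  too-many : ∀ {m} {c : Fin (3 + m) → Fin _} → Injective _≡_ _≡_ c → c zero ≡ a ⊎ c zero ≡ b →
             c (suc zero) ≡ a ⊎ c (suc zero) ≡ b → c (suc (suc zero)) ≡ a ⊎ c (suc (suc zero)) ≡ b → ⊥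
  too-many c-inj (inj₁ p) (inj₁ q) _ = case c-inj (trans p (sym q)) of λ ()
  too-many c-inj (inj₂ p) (inj₂ q) _ = case c-inj (trans p (sym q)) of λ ()
  too-many c-inj (inj₁ p) (inj₂ q) (inj₁ r) = case c-inj (trans p (sym r)) of λ ()
  too-many c-inj (inj₁ p) (inj₂ q) (inj₂ r) = case c-inj (trans q (sym r)) of λ ()
  too-many c-inj (inj₂ p) (inj₁ q) (inj₁ r) = case c-inj (trans q (sym r)) of λ ()
  too-many c-inj (inj₂ p) (inj₁ q) (inj₂ r) = case c-inj (trans p (sym r)) of λ ()

edgeGraph : (a b : Fin n) → a ≢ b → Graph n
edgeGraph a b a≢b = decGraph {P = λ u → u ≡ a ⊎ u ≡ b} {Q = λ u v → (u ≡ a × v ≡ b) ⊎ (u ≡ b × v ≡ a)}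
  (λ u → (u Fin.≟ a) ⊎-dec (u Fin.≟ b))
  (λ u v → ((u Fin.≟ a) ×-dec (v Fin.≟ b)) ⊎-dec ((u Fin.≟ b) ×-dec (v Fin.≟ a)))
  (λ { (inj₁ (p , q)) → inj₂ (q , p) ; (inj₂ (p , q)) → inj₁ (q , p) })
  (λ { (inj₁ (p , q)) → a≢b (trans (sym p) q) ; (inj₂ (p , q)) → a≢b (trans (sym q) p) })
  (λ { (inj₁ (p , _)) → inj₁ p ; (inj₂ (p , _)) → inj₂ p })

edgeGraph-isSingleEdge : (a≢b : a ≢ b) → IsSingleEdge (edgeGraph a b a≢b)
edgeGraph-isSingleEdge {a = a} {b} a≢b = a , b , a≢b ,
  (λ u → does⇔ ((u Fin.≟ a) ⊎-dec (u Fin.≟ b))) ,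
  (λ u v → does⇔ (((u Fin.≟ a) ×-dec (v Fin.≟ b)) ⊎-dec ((u Fin.≟ b) ×-dec (v Fin.≟ a))))

-- A cycle is glued from any one of its edges and itself.
isCycle-cyclic : (G : Graph n) → IsCycle G → CyclicallyOrientable G
isCycle-cyclic G cycle@(m , c , c-inj , V⇔ , E⇔) =
  Decomposition.glue G G′ G
    (G′⊆G , ((λ _ → id) , (λ _ _ → id)) , cycle ,
     (λ u → true-⇔ (λ e → ∨-join (inj₂ e)) ([ proj₁ G′⊆G u , id ]′ ∘ ∨-split (V G′ u))) ,
     (λ u v → true-⇔ (λ e → ∨-join (inj₂ e)) ([ proj₂ G′⊆G u v , id ]′ ∘ ∨-split (E G′ u v))) ,
     u₀ , v₀ , Equivalence.from (E′⇔ u₀ v₀) (inj₁ (refl , refl)) , u₀~v₀ ,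
     (λ u → mk⇔ (Equivalence.to (V′⇔ u) ∘ proj₁)
       λ u∈ → Equivalence.from (V′⇔ u) u∈ , proj₁ G′⊆G u (Equivalence.from (V′⇔ u) u∈)) ,
     (λ u v → Equivalence.to (E′⇔ u v) ∘ proj₁))
    (singleEdge-cyclic G′ single)
  where
  u₀ = c zero
  v₀ = c (next zero)
  u₀~v₀ : Adj G u₀ v₀
  u₀~v₀ = Equivalence.from (E⇔ u₀ v₀) (zero , inj₁ (refl , refl))
  G′ = edgeGraph u₀ v₀ (adj⇒≢ G u₀~v₀)
  single = edgeGraph-isSingleEdge (adj⇒≢ G u₀~v₀)
  V′⇔ = proj₁ (proj₂ (proj₂ (proj₂ single)))
  E′⇔ = proj₂ (proj₂ (proj₂ (proj₂ single)))
  G′⊆G : G′ ⊆G G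
  G′⊆G =
    (λ u e → case Equivalence.to (V′⇔ u) e of λ
      { (inj₁ refl) → adj-V G u₀~v₀ ; (inj₂ refl) → adj-V G (adj-sym G u₀~v₀) }) ,
    (λ u v e → case Equivalence.to (E′⇔ u v) e of λ
      { (inj₁ (refl , refl)) → u₀~v₀ ; (inj₂ (refl , refl)) → adj-sym G u₀~v₀ })

-- The three statements assembled

theorem1 : (n : ℕ) →
    ((G : Graph n) →
    CyclicallyOrientable G ⇔
    ((K : Graph n) → IsTwoConnComponent G K → CyclicallyOrientable K))
    × ((G : Graph n) → TwoConnected G →
    CyclicallyOrientable G ⇔
    (IsCycle G ⊎ IsSingleEdge G
    ⊎ (Σ[ G' ∈ Graph n ] Σ[ C ∈ Graph n ]
    IsCycleDecomposition G G' C × CyclicallyOrientable G')))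
    × ((G G' C : Graph n) → TwoConnected G → IsCycleDecomposition G G' C →
    CyclicallyOrientable G ⇔ CyclicallyOrientable G')
theorem1 n =
  (λ G → mk⇔ (λ co K isK → component-cyclic G K isK co) (components-cyclic G)) ,
  (λ G two → mk⇔
    -- A cycle appears here as a split: itself glued to one of its edges.
    (λ (o , cyc) → inj₂ (Sum.map₂
      (λ (G′ , C , dec) → G′ , C , dec , Decomposition.unglue G G′ C dec (o , cyc))
      (edge-or-split G cyc two)))
    λ { (inj₁ cycle)                         → isCycle-cyclic G cycle
      ; (inj₂ (inj₁ edge))                   → singleEdge-cyclic G edge
      ; (inj₂ (inj₂ (G′ , C , dec , co′)))   → Decomposition.glue G G′ C dec co′ }) ,
  λ G G′ C _ dec → mk⇔ (Decomposition.unglue G G′ C dec) (Decomposition.glue G G′ C dec)
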